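{- Let $k,l$ be positive integers and let $M$ be a matroid with Tutte polynomial $T_M(x,y)=\sum_{i,j\ge 0}t_{i,j}x^iy^j$. Then $M$ is almost $(k,l)$-uniform if and only if $t_{k,l}\le 1$ and $t_{i,j}=0$ for every pair $(i,j)>(k,l)$.
   Context: For pairs of integers, $(i,j)>(k,l)$ means $i\ge k$, $j\ge l$ and $(i,j)\neq(k,l)$. For positive integers $k,l$, a matroid is $(k,l)$-uniform if it has no minor isomorphic to $U_{k,k}\oplus U_{0,l}$ ($k$ coloops and $l$ loops). A matroid $M$ is almost $(k,l)$-uniform if for every element $v$ of its ground set, at least one of $M-v$ (deletion) or $M/v$ (contraction) is $(k,l)$-uniform. The Tutte polynomial is $T_M(x,y)=\sum_B x^{\mathrm{int}(B)}y^{\mathrm{ext}(B)}$ over all bases $B$, where, for a fixed total order on the ground set $E$, $\mathrm{int}(B)$ counts $v\in B$ which are the smallest element of the unique cocircuit contained in $(E-B)\cup\{v\}$ and $\mathrm{ext}(B)$ counts $v\notin B$ which are the smallest element of the unique circuit contained in $B\cup\{v\}$; it is independent of the order. -}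

module Defs where

open import Data.Nat using (ℕ; zero; suc; _+_; _≤_; _<_; _⊔_; _≡ᵇ_)
open import Data.Bool using (Bool; true; false; _∧_; _∨_; not; if_then_else_)
open import Data.Fin using (Fin; _≤?_; _<?_)
open import Data.Fin.Subset using (Subset; _∈_; _∉_; _⊆_; _∪_; _∩_; ∁; ⁅_⁆; _─_; _-_; ∣_∣; ⊤; ⊥)
open import Data.Vec using (Vec; []; _∷_; lookup; map)
open import Data.List as L using (List; []; _∷_; _++_; length; foldr)
open import Data.Sum using (_⊎_)
open import Data.Product using (_×_; Σ; ∃; ∃-syntax; _,_)
open import Function.Bundles using (_⇔_)
open import Relation.Nullary using (¬_; does)
open import Relation.Binary.PropositionalEquality using (_≡_)

allSubsets : (n : ℕ) → List (Subset n)
allSubsets zero = [] ∷ []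
allSubsets (suc n) = L.map (false ∷_) (allSubsets n) ++ L.map (true ∷_) (allSubsets n)

allElems : (n : ℕ) → List (Fin n)
allElems n = L.allFin n

allL : {A : Set} → (A → Bool) → List A → Bool
allL p = foldr (λ a b → p a ∧ b) true

anyL : {A : Set} → (A → Bool) → List A → Bool
anyL p = foldr (λ a b → p a ∨ b) false

countL : {A : Set} → (A → Bool) → List A → ℕ
countL p = foldr (λ a c → if p a then suc c else c) 0

memᵇ : {n : ℕ} → Fin n → Subset n → Bool
memᵇ x p = lookup p x

subᵇ : {n : ℕ} → Subset n → Subset n → Bool
subᵇ {n} p q = allL (λ x → not (memᵇ x p) ∨ memᵇ x q) (allElems n)

record Matroid (n : ℕ) : Set where
  field
    indep : Subset n → Bool
    indep-empty : indep ⊥ ≡ true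
    indep-hereditary : ∀ X Y → Y ⊆ X → indep X ≡ true → indep Y ≡ true
    indep-augment : ∀ X Y → indep X ≡ true → indep Y ≡ true → ∣ X ∣ < ∣ Y ∣ →
                    ∃[ e ] (e ∈ Y × e ∉ X × indep (X ∪ ⁅ e ⁆) ≡ true)

open Matroid public

module _ {n : ℕ} (M : Matroid n) where

  rank : Subset n → ℕ
  rank X = foldr (λ Y r → (if subᵇ Y X ∧ indep M Y then ∣ Y ∣ else 0) ⊔ r) 0 (allSubsets n)

  isBasis : Subset n → Bool
  isBasis B = indep M B ∧ allL (λ e → memᵇ e B ∨ not (indep M (B ∪ ⁅ e ⁆))) (allElems n)

  isCircuit : Subset n → Bool
  isCircuit C = not (indep M C) ∧ allL (λ e → not (memᵇ e C) ∨ indep M (C - e)) (allElems n)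

  coindep : Subset n → Bool
  coindep X = anyL (λ B → isBasis B ∧ subᵇ B (∁ X)) (allSubsets n)

  isCocircuit : Subset n → Bool
  isCocircuit C = not (coindep C) ∧ allL (λ e → not (memᵇ e C) ∨ coindep (C - e)) (allElems n)

  smallestIn : Fin n → Subset n → Bool
  smallestIn v C = allL (λ e → not (memᵇ e C) ∨ does (v ≤? e)) (allElems n)

  -- v ∈ B is internally active: v is the smallest element of the (unique)
  -- cocircuit contained in (E - B) ∪ {v}
  intActive : Subset n → Fin n → Bool
  intActive B v = memᵇ v B ∧
    allL (λ C → not (isCocircuit C ∧ subᵇ C (∁ B ∪ ⁅ v ⁆)) ∨ smallestIn v C) (allSubsets n)

  -- v ∉ B is externally active: v is the smallest element of the (unique)
  -- circuit contained in B ∪ {v}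
  extActive : Subset n → Fin n → Bool
  extActive B v = not (memᵇ v B) ∧
    allL (λ C → not (isCircuit C ∧ subᵇ C (B ∪ ⁅ v ⁆)) ∨ smallestIn v C) (allSubsets n)

  int : Subset n → ℕ
  int B = countL (intActive B) (allElems n)

  ext : Subset n → ℕ
  ext B = countL (extActive B) (allElems n)

  -- coefficient t_{i,j} of x^i y^j in the Tutte polynomial
  -- T_M(x,y) = Σ_B x^int(B) y^ext(B)
  tutteCoeff : ℕ → ℕ → ℕ
  tutteCoeff i j = countL (λ B → isBasis B ∧ (int B ≡ᵇ i) ∧ (ext B ≡ᵇ j)) (allSubsets n)

  -- Minors.  The minor M / C₀ \ D₀ is represented by its ground set
  -- S = E - C₀ - D₀ together with the contracted set C₀ (S ∩ C₀ = ∅).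
  -- A subset X ⊆ S is independent in M / C₀ \ D₀ iff r(X ∪ C₀) = |X| + r(C₀).

  IndepIn : (S C₀ : Subset n) → Subset n → Set
  IndepIn S C₀ X = X ⊆ S × rank (X ∪ C₀) ≡ ∣ X ∣ + rank C₀

  -- the minor (S , C₀) has a minor isomorphic to U_{k,k} ⊕ U_{0,l}:
  -- we contract C ⊆ S, delete the rest of S except K ∪ L, and the resulting
  -- matroid on K ∪ L (|K| = k, |L| = l, disjoint) has as independent sets
  -- exactly the subsets of K (K = coloops, L = loops)
  HasUkkU0lMinor : (S C₀ : Subset n) → ℕ → ℕ → Set
  HasUkkU0lMinor S C₀ k l =
    Σ (Subset n) λ C → Σ (Subset n) λ K → Σ (Subset n) λ L →
      C ⊆ S × K ⊆ S × L ⊆ S ×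
      (C ∩ K) ≡ ⊥ × (C ∩ L) ≡ ⊥ × (K ∩ L) ≡ ⊥ ×
      ∣ K ∣ ≡ k × ∣ L ∣ ≡ l ×
      (∀ X → X ⊆ (K ∪ L) → (IndepIn (K ∪ L) (C₀ ∪ C) X ⇔ X ⊆ K))

  UniformIn : (S C₀ : Subset n) → ℕ → ℕ → Set
  UniformIn S C₀ k l = ¬ HasUkkU0lMinor S C₀ k l

  -- M - v is (S , C₀) = (E - v , ∅) ; M / v is (E - v , {v})
  AlmostUniform : ℕ → ℕ → Set
  AlmostUniform k l = ∀ (v : Fin n) →
    UniformIn (⊤ - v) ⊥ k l ⊎ UniformIn (⊤ - v) ⁅ v ⁆ k l

_>₂_ : ℕ × ℕ → ℕ × ℕ → Set
(i , j) >₂ (k , l) = k ≤ i × l ≤ j × ¬ ((i , j) ≡ (k , l))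

{-# OPTIONS --safe #-}
module Submission where

-- Call A large if r(E) − r(A) ≥ k and |A| − r(A) ≥ l.  Both conditions of the theorem say that
-- there is at most one large set.
--
-- A minor U_{k,k} ⊕ U_{0,l} of M − v (of M / v) yields a large set avoiding (containing) v.
-- Conversely, large sets A ∋ v and A′ ∌ v yield such minors of both M − v and M / v; if v is a
-- coloop, A − v replaces A′ in the deletion, and if v is a loop, A′ ∪ v replaces A in the
-- contraction.
--
-- By Crapo's theorem each A satisfies B − IA(B) ⊆ A ⊆ B ∪ EA(B) for exactly one basis B, where IA
-- and EA are the sets of internally and externally active elements; then r(E) − r(A) = |B − A| and
-- |A| − r(A) = |A − B|.  Here B is the basis of largest weight when the elements of A outweigh
-- those outside A, and weights increase along the order inside A and decrease outside A.
-- So the largest corank and nullity in the interval of B, int(B) and ext(B), are attained together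
-- at (B − IA(B)) ∪ EA(B).

open import Defs
open import Data.Bool using (Bool; true; false; _∧_; _∨_; not; if_then_else_)
import Data.Bool.Properties as Bool
open import Data.Fin as Fin using (Fin; zero; suc; toℕ)
import Data.Fin.Properties as Fin
open import Data.Fin.Subset using (Subset; _∈_; _∉_; _⊆_; _∪_; _∩_; ∁; ⁅_⁆; _─_; _-_; ∣_∣; ⊤; ⊥)
open import Data.Fin.Subset.Properties
open import Data.List as L using ([]; _∷_; foldr; allFin; filter; map)
open import Data.List.Membership.Propositional using () renaming (_∈_ to _∈ₗ_)
open import Data.List.Membership.Propositional.Properties
  using (∈-map⁺; ∈-map⁻; ∈-++⁺ˡ; ∈-++⁺ʳ; ∈-allFin; ∈-filter⁺)
import Data.List.Relation.Unary.All as All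
open import Data.List.Relation.Unary.All.Properties using (all-filter)
open import Data.List.Relation.Unary.Any using (here; there)
import Data.List.Extrema as Extrema
import Data.List.Relation.Unary.AllPairs as AllPairs
open import Data.List.Relation.Unary.Unique.Propositional using (Unique)
import Data.List.Relation.Unary.Unique.Propositional.Properties as Unique
open import Data.Nat using (ℕ; zero; suc; _+_; _∸_; _≤_; _<_; _⊔_; _≡ᵇ_; z≤n; s≤s; s≤s⁻¹)
open import Data.Nat.Properties renaming (_≟_ to _≟ℕ_)
open import Data.Nat.Tactic.RingSolver using (solve-∀)
open import Data.Product using (_×_; ∃-syntax; _,_; proj₁; proj₂)
open import Data.Product.Properties using (≡-dec)
open import Data.Sum using (_⊎_; inj₁; inj₂; [_,_]′)
open import Data.Vec using ([]; _∷_; lookup; here; there; tabulate)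
open import Data.Vec.Properties using ([]=⇒lookup; lookup⇒[]=; lookup∘tabulate; ∷-injectiveʳ)
open import Function using (_∘_; id)
open import Function.Bundles using (_⇔_; mk⇔; Equivalence)
open import Relation.Binary.PropositionalEquality
  using (_≡_; _≢_; refl; sym; trans; cong; cong₂; subst; module ≡-Reasoning)
open import Relation.Nullary using (¬_; Dec; does; yes; no; contradiction)
open import Relation.Nullary.Decidable using (_×-dec_; _⊎-dec_; ¬?; dec-true; map′; decidable-stable)
open import Relation.Unary using (Decidable)

-- Finite sets

module _ {n : ℕ} {p q : Subset n} where

  x∈p─q⁻ : ∀ {x} → x ∈ p ─ q → x ∈ p × x ∉ q
  x∈p─q⁻ {x} x∈ = p─q⊆p p q x∈ , ∉q p q x∈
    where
    ∉q : ∀ {n} (p q : Subset n) {x} → x ∈ p ─ q → x ∉ q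
    ∉q (_ ∷ p) (_ ∷ q) (there x∈) (there x∈q) = ∉q p q x∈ x∈q
    ∉q (true ∷ p) (true ∷ q) () here

  ⊆∧∣≥∣⇒⊇ : p ⊆ q → ∣ q ∣ ≤ ∣ p ∣ → q ⊆ p
  ⊆∧∣≥∣⇒⊇ p⊆q q≤p {x} x∈q with x ∈? p
  ... | yes x∈p = x∈p
  ... | no x∉p = contradiction (p⊂q⇒∣p∣<∣q∣ (p⊆q , x , x∈q , x∉p)) (≤⇒≯ q≤p)

  ∣p∣<∣q∣⇒∃ : ∣ p ∣ < ∣ q ∣ → ∃[ x ] (x ∈ q × x ∉ p)
  ∣p∣<∣q∣⇒∃ p<q with Fin.any? (λ x → (x ∈? q) ×-dec ¬? (x ∈? p))
  ... | yes w = w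
  ... | no ∄ = contradiction (p⊆q⇒∣p∣≤∣q∣ q⊆p) (<⇒≱ p<q)
    where
    q⊆p : q ⊆ p
    q⊆p {x} x∈q with x ∈? p
    ... | yes x∈p = x∈p
    ... | no x∉p = contradiction (x , x∈q , x∉p) ∄

∣p∣≡∣p∩q∣+∣p─q∣ : ∀ {n} (p q : Subset n) → ∣ p ∣ ≡ ∣ p ∩ q ∣ + ∣ p ─ q ∣
∣p∣≡∣p∩q∣+∣p─q∣ [] [] = refl
∣p∣≡∣p∩q∣+∣p─q∣ (false ∷ p) (false ∷ q) = ∣p∣≡∣p∩q∣+∣p─q∣ p q
∣p∣≡∣p∩q∣+∣p─q∣ (false ∷ p) (true ∷ q) = ∣p∣≡∣p∩q∣+∣p─q∣ p q
∣p∣≡∣p∩q∣+∣p─q∣ (true ∷ p) (true ∷ q) = cong suc (∣p∣≡∣p∩q∣+∣p─q∣ p q)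
∣p∣≡∣p∩q∣+∣p─q∣ (true ∷ p) (false ∷ q) =
  trans (cong suc (∣p∣≡∣p∩q∣+∣p─q∣ p q)) (sym (+-suc ∣ p ∩ q ∣ ∣ p ─ q ∣))

∃⊆-of-size : ∀ {n} (p : Subset n) m → m ≤ ∣ p ∣ → ∃[ q ] (q ⊆ p × ∣ q ∣ ≡ m)
∃⊆-of-size [] .zero z≤n = [] , id , refl
∃⊆-of-size (false ∷ p) m m≤ = let q , q⊆p , q≡ = ∃⊆-of-size p m m≤ in false ∷ q , s⊆s q⊆p , q≡
∃⊆-of-size {suc n} (true ∷ p) zero m≤ = ⊥ , ⊥⊆ , ∣⊥∣≡0 (suc n)
∃⊆-of-size (true ∷ p) (suc m) (s≤s m≤) =
  let q , q⊆p , q≡ = ∃⊆-of-size p m m≤ in true ∷ q , s⊆s q⊆p , cong suc q≡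

weight : ∀ {n} → (Fin n → ℕ) → Subset n → ℕ
weight w [] = 0
weight w (b ∷ p) = (if b then w zero else 0) + weight (w ∘ suc) p

weight-∪⁅⁆ : ∀ {n} (w : Fin n → ℕ) (p : Subset n) {x} → x ∉ p → weight w (p ∪ ⁅ x ⁆) ≡ w x + weight w p
weight-∪⁅⁆ w (true ∷ p) {zero} x∉p = contradiction here x∉p
weight-∪⁅⁆ w (false ∷ p) {zero} x∉p = cong (λ q → w zero + weight (w ∘ suc) q) (∪-identityʳ p)
weight-∪⁅⁆ w (b ∷ p) {suc x} x∉p rewrite Bool.∨-identityʳ b | weight-∪⁅⁆ (w ∘ suc) p (x∉p ∘ there) =
  x∙yz≈y∙xz (if b then w zero else 0) (w (suc x)) (weight (w ∘ suc) p)
  where open import Algebra.Properties.CommutativeSemigroup +-commutativeSemigroup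

weight-1 : ∀ {n} (p : Subset n) → weight (λ _ → 1) p ≡ ∣ p ∣
weight-1 [] = refl
weight-1 (true ∷ p) = cong suc (weight-1 p)
weight-1 (false ∷ p) = weight-1 p

∣p∪⁅x⁆∣ : ∀ {n} (p : Subset n) {x} → x ∉ p → ∣ p ∪ ⁅ x ⁆ ∣ ≡ suc ∣ p ∣
∣p∪⁅x⁆∣ p {x} x∉p = begin
  ∣ p ∪ ⁅ x ⁆ ∣                ≡⟨ sym (weight-1 (p ∪ ⁅ x ⁆)) ⟩
  weight (λ _ → 1) (p ∪ ⁅ x ⁆) ≡⟨ weight-∪⁅⁆ _ p x∉p ⟩
  suc (weight (λ _ → 1) p)     ≡⟨ cong suc (weight-1 p) ⟩
  suc ∣ p ∣                    ∎
  where open ≡-Reasoning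

module _ {n : ℕ} {p : Subset n} where

  x∉p-x : ∀ {x} → x ∉ p - x
  x∉p-x {x} x∈ = proj₂ (x∈p─q⁻ {p = p} x∈) (x∈⁅x⁆ x)

  x∈p-y⁻ : ∀ {x y} → x ∈ p - y → x ∈ p × x ≢ y
  x∈p-y⁻ x∈ = p─q⊆p p _ x∈ , λ { refl → x∉p-x x∈ }

  x∈p∪⁅y⁆⁻ : ∀ {x y} → x ∈ p ∪ ⁅ y ⁆ → x ∈ p ⊎ x ≡ y
  x∈p∪⁅y⁆⁻ {y = y} x∈ with x∈p∪q⁻ p ⁅ y ⁆ x∈
  ... | inj₁ x∈p = inj₁ x∈p
  ... | inj₂ x∈y = inj₂ (x∈⁅y⁆⇒x≡y y x∈y)

  x∈p∪⁅x⁆ : ∀ {x} → x ∈ p ∪ ⁅ x ⁆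
  x∈p∪⁅x⁆ {x} = q⊆p∪q p ⁅ x ⁆ (x∈⁅x⁆ x)

  p∪⁅x⁆⊆ : ∀ {q x} → p ⊆ q → x ∈ q → p ∪ ⁅ x ⁆ ⊆ q
  p∪⁅x⁆⊆ p⊆q x∈q y∈ with x∈p∪⁅y⁆⁻ y∈
  ... | inj₁ y∈p = p⊆q y∈p
  ... | inj₂ refl = x∈q

  p∪q⊆ : ∀ {q r} → p ⊆ r → q ⊆ r → p ∪ q ⊆ r
  p∪q⊆ {q} p⊆r q⊆r x∈ = [ p⊆r , q⊆r ]′ (x∈p∪q⁻ p q x∈)

  [p-x]∪⁅x⁆≡p : ∀ {x} → x ∈ p → (p - x) ∪ ⁅ x ⁆ ≡ p
  [p-x]∪⁅x⁆≡p {x} x∈p = ⊆-antisym (to ∘ x∈p∪q⁻ (p - x) ⁅ x ⁆) from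
    where
    to : ∀ {y} → y ∈ p - x ⊎ y ∈ ⁅ x ⁆ → y ∈ p
    to (inj₁ y∈) = p─q⊆p p ⁅ x ⁆ y∈
    to (inj₂ y∈) rewrite x∈⁅y⁆⇒x≡y x y∈ = x∈p
    from : p ⊆ (p - x) ∪ ⁅ x ⁆
    from {y} y∈p with y Fin.≟ x
    ... | yes refl = q⊆p∪q (p - x) ⁅ x ⁆ (x∈⁅x⁆ x)
    ... | no y≢x = p⊆p∪q ⁅ x ⁆ (x∈p∧x≢y⇒x∈p-y y∈p y≢x)

  weight-minus : ∀ (w : Fin n → ℕ) {x} → x ∈ p → w x + weight w (p - x) ≡ weight w p
  weight-minus w {x} x∈p =
    trans (sym (weight-∪⁅⁆ w (p - x) x∉p-x)) (cong (weight w) ([p-x]∪⁅x⁆≡p x∈p))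

  ∣p-x∣ : ∀ {x} → x ∈ p → suc ∣ p - x ∣ ≡ ∣ p ∣
  ∣p-x∣ {x} x∈p = trans (sym (∣p∪⁅x⁆∣ (p - x) x∉p-x)) (cong ∣_∣ ([p-x]∪⁅x⁆≡p x∈p))

∣p∪q∣-disjoint : ∀ {n} (p q : Subset n) → (∀ {x} → x ∈ p → x ∉ q) → ∣ p ∪ q ∣ ≡ ∣ p ∣ + ∣ q ∣
∣p∪q∣-disjoint p q disj = trans (∣p∣≡∣p∩q∣+∣p─q∣ (p ∪ q) p) (cong₂ _+_
  (cong ∣_∣ (⊆-antisym (p∩q⊆q (p ∪ q) p) (λ x∈p → x∈p∩q⁺ (p⊆p∪q q x∈p , x∈p))))
  (cong ∣_∣ (⊆-antisym to (λ x∈q → x∈p∧x∉q⇒x∈p─q (q⊆p∪q p q x∈q) (λ x∈p → disj x∈p x∈q)))))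
  where
  to : (p ∪ q) ─ p ⊆ q
  to x∈ with x∈p─q⁻ x∈
  ... | x∈∪ , x∉p with x∈p∪q⁻ p q x∈∪
  ... | inj₁ x∈p = contradiction x∈p x∉p
  ... | inj₂ x∈q = x∈q

module _ {n : ℕ} {p q : Subset n} where

  disjoint⇒∩≡⊥ : (∀ {x} → x ∈ p → x ∉ q) → p ∩ q ≡ ⊥
  disjoint⇒∩≡⊥ disj = Empty-unique λ (x , x∈) → let x∈p , x∈q = x∈p∩q⁻ p q x∈ in disj x∈p x∈q

  ∩≡⊥⇒disjoint : p ∩ q ≡ ⊥ → ∀ {x} → x ∈ p → x ∉ q
  ∩≡⊥⇒disjoint ≡⊥ x∈p x∈q = ∉⊥ (subst (_ ∈_) ≡⊥ (x∈p∩q⁺ (x∈p , x∈q)))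

-- The Boolean combinators

∧-true⁻ : ∀ {a b} → a ∧ b ≡ true → a ≡ true × b ≡ true
∧-true⁻ {true} {true} _ = refl , refl

∧-true⁺ : ∀ {a b} → a ≡ true → b ≡ true → a ∧ b ≡ true
∧-true⁺ refl refl = refl

not-true⁻ : ∀ {a} → not a ≡ true → a ≢ true
not-true⁻ {false} _ ()

not-true⁺ : ∀ {a} → a ≢ true → not a ≡ true
not-true⁺ {true} a≢ = contradiction refl a≢
not-true⁺ {false} _ = refl

⇒-true⁻ : ∀ {a b} → not a ∨ b ≡ true → a ≡ true → b ≡ true
⇒-true⁻ {true} h refl = h

⇒-true⁺ : ∀ {a b} → (a ≡ true → b ≡ true) → not a ∨ b ≡ true
⇒-true⁺ {true} h = h refl
⇒-true⁺ {false} h = refl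

does⁻ : ∀ {A : Set} (A? : Dec A) → does A? ≡ true → A
does⁻ (yes a) _ = a

module _ {A : Set} {P : A → Bool} where

  allL⁻ : ∀ {xs} → allL P xs ≡ true → ∀ {x} → x ∈ₗ xs → P x ≡ true
  allL⁻ h (here refl) = proj₁ (∧-true⁻ h)
  allL⁻ {y ∷ _} h (there x∈) = allL⁻ (proj₂ (∧-true⁻ {P y} h)) x∈

  allL⁺ : ∀ xs → (∀ x → P x ≡ true) → allL P xs ≡ true
  allL⁺ [] h = refl
  allL⁺ (x ∷ xs) h = ∧-true⁺ (h x) (allL⁺ xs h)

  anyL⁻ : ∀ xs → anyL P xs ≡ true → ∃[ x ] P x ≡ true
  anyL⁻ (x ∷ xs) h with P x in eq
  ... | true = x , eq
  ... | false = anyL⁻ xs h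

  anyL⁺ : ∀ {xs x} → x ∈ₗ xs → P x ≡ true → anyL P xs ≡ true
  anyL⁺ (here refl) Px rewrite Px = refl
  anyL⁺ {y ∷ _} (there x∈) Px rewrite anyL⁺ x∈ Px = Bool.∨-zeroʳ (P y)

  countL>0⁻ : ∀ xs → countL P xs ≢ 0 → ∃[ x ] (x ∈ₗ xs × P x ≡ true)
  countL>0⁻ [] h = contradiction refl h
  countL>0⁻ (x ∷ xs) h with P x in eq
  ... | true = x , here refl , eq
  ... | false = let y , y∈ , Py = countL>0⁻ xs h in y , there y∈ , Py

  countL>0⁺ : ∀ {xs x} → x ∈ₗ xs → P x ≡ true → countL P xs ≢ 0
  countL>0⁺ (here refl) Px rewrite Px = λ ()
  countL>0⁺ {y ∷ _} (there x∈) Px with P y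
  ... | true = λ ()
  ... | false = countL>0⁺ x∈ Px

  countL≤1⁻ : ∀ {xs} → countL P xs ≤ 1 → ∀ {x y} → x ∈ₗ xs → y ∈ₗ xs →
              P x ≡ true → P y ≡ true → x ≡ y
  countL≤1⁻ h (here refl) (here refl) Px Py = refl
  countL≤1⁻ h (here refl) (there y∈) Px Py rewrite Px =
    contradiction (n≤0⇒n≡0 (s≤s⁻¹ h)) (countL>0⁺ y∈ Py)
  countL≤1⁻ h (there x∈) (here refl) Px Py rewrite Py =
    contradiction (n≤0⇒n≡0 (s≤s⁻¹ h)) (countL>0⁺ x∈ Px)
  countL≤1⁻ {z ∷ _} h (there x∈) (there y∈) Px Py with P z
  ... | true = contradiction (n≤0⇒n≡0 (s≤s⁻¹ h)) (countL>0⁺ x∈ Px)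
  ... | false = countL≤1⁻ h x∈ y∈ Px Py

  countL≤1⁺ : ∀ {xs} → Unique xs → (∀ {x y} → P x ≡ true → P y ≡ true → x ≡ y) → countL P xs ≤ 1
  countL≤1⁺ AllPairs.[] h = z≤n
  countL≤1⁺ {x ∷ xs} (x∉xs AllPairs.∷ uniq) h with P x in Px
  ... | false = countL≤1⁺ uniq h
  ... | true with countL P xs ≟ℕ 0
  ... | yes ≡0 rewrite ≡0 = s≤s z≤n
  ... | no ≢0 = let y , y∈ , Py = countL>0⁻ xs ≢0 in contradiction (h Px Py) (All.lookup x∉xs y∈)

∈-allSubsets : ∀ {n} (p : Subset n) → p ∈ₗ allSubsets n
∈-allSubsets [] = here refl
∈-allSubsets (false ∷ p) = ∈-++⁺ˡ (∈-map⁺ (false ∷_) (∈-allSubsets p))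
∈-allSubsets {suc n} (true ∷ p) = ∈-++⁺ʳ (map (false ∷_) (allSubsets n)) (∈-map⁺ (true ∷_) (∈-allSubsets p))

allSubsets-unique : ∀ n → Unique (allSubsets n)
allSubsets-unique zero = All.[] AllPairs.∷ AllPairs.[]
allSubsets-unique (suc n) = Unique.++⁺ (Unique.map⁺ ∷-injectiveʳ (allSubsets-unique n))
  (Unique.map⁺ ∷-injectiveʳ (allSubsets-unique n)) disjoint
  where
  disjoint : ∀ {p} → ¬ (p ∈ₗ map (false ∷_) (allSubsets n) × p ∈ₗ map (true ∷_) (allSubsets n))
  disjoint (p∈₁ , p∈₂) with ∈-map⁻ (false ∷_) p∈₁ | ∈-map⁻ (true ∷_) p∈₂
  ... | _ , _ , refl | _ , _ , ()

subᵇ⁻ : ∀ {n} {p q : Subset n} → subᵇ p q ≡ true → p ⊆ q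
subᵇ⁻ h {x} x∈p = lookup⇒[]= _ _ (⇒-true⁻ (allL⁻ h (∈-allFin x)) ([]=⇒lookup x∈p))

subᵇ⁺ : ∀ {n} {p q : Subset n} → p ⊆ q → subᵇ p q ≡ true
subᵇ⁺ {p = p} p⊆q = allL⁺ (allFin _) (λ x → ⇒-true⁺ (λ h → []=⇒lookup (p⊆q (lookup⇒[]= x p h))))

-- Since `allFin n` is `tabulate id`, this turns the counts `int` and `ext` into sizes of subsets.
countL-tabulate : ∀ {A : Set} {n} (P : A → Bool) (f : Fin n → A) →
                  countL P (L.tabulate f) ≡ ∣ tabulate (P ∘ f) ∣
countL-tabulate {n = zero} P f = refl
countL-tabulate {n = suc n} P f with P (f zero)
... | true = cong suc (countL-tabulate P (f ∘ suc))
... | false = countL-tabulate P (f ∘ suc)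

module _ {A : Set} {P : A → Set} (P? : Decidable P) (w : A → ℕ) where

  open Extrema ≤-totalOrder using (argmax; argmax-all; f[xs]≤f[argmax])

  maximiser : ∀ xs {x₀} → P x₀ → ∃[ m ] (P m × (∀ {y} → y ∈ₗ xs → P y → w y ≤ w m))
  -- `x₀` is the default value of `argmax`; as it satisfies `P`, so does the result in every case.
  maximiser xs {x₀} Px₀ = argmax w x₀ (filter P? xs) , argmax-all w Px₀ (all-filter P? xs) ,
    λ y∈xs Py → All.lookup (f[xs]≤f[argmax] x₀ (filter P? xs)) (∈-filter⁺ P? y∈xs Py)

-- Circuits of hereditary families

-- isCircuit M and isCocircuit M are the instances P = indep M and P = coindep M.
isMinimalNon : ∀ {n} → (Subset n → Bool) → Subset n → Bool
isMinimalNon {n} P C = not (P C) ∧ allL (λ e → not (memᵇ e C) ∨ P (C - e)) (allElems n)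

module Hereditary {n : ℕ} (P : Subset n → Bool)
  (hereditary : ∀ X Y → Y ⊆ X → P X ≡ true → P Y ≡ true) where

  minimalNon⁻ : ∀ {C} → isMinimalNon P C ≡ true → P C ≢ true × (∀ {e} → e ∈ C → P (C - e) ≡ true)
  minimalNon⁻ h = let h₁ , h₂ = ∧-true⁻ h in
    not-true⁻ h₁ , λ {e} e∈C → ⇒-true⁻ (allL⁻ h₂ (∈-allFin e)) ([]=⇒lookup e∈C)

  minimalNon⁺ : ∀ {C} → P C ≢ true → (∀ {e} → e ∈ C → P (C - e) ≡ true) → isMinimalNon P C ≡ true
  minimalNon⁺ {C} ¬PC h = ∧-true⁺ (not-true⁺ ¬PC)
    (allL⁺ (allFin n) (λ e → ⇒-true⁺ (λ e∈ → h (lookup⇒[]= e C e∈))))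

  -- While the removal of some element leaves a non-member, that element is removed; the size `m`
  -- decreases.
  ∃minimalNon : ∀ D → P D ≢ true → ∃[ C ] (C ⊆ D × isMinimalNon P C ≡ true)
  ∃minimalNon D = go ∣ D ∣ D refl
    where
    go : ∀ m D → ∣ D ∣ ≡ m → P D ≢ true → ∃[ C ] (C ⊆ D × isMinimalNon P C ≡ true)
    go m D D≡m ¬PD with Fin.any? (λ e → (e ∈? D) ×-dec ¬? (P (D - e) Bool.≟ true))
    ... | no ∄ = D , id , minimalNon⁺ ¬PD
      (λ {e} e∈D → decidable-stable (P (D - e) Bool.≟ true) (λ ¬P → ∄ (e , e∈D , ¬P)))
    go zero D D≡m ¬PD | yes (e , e∈D , _) = contradiction (trans (∣p-x∣ e∈D) D≡m) λ ()
    go (suc m) D D≡m ¬PD | yes (e , e∈D , ¬P) =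
      let C , C⊆ , minC = go m (D - e) (suc-injective (trans (∣p-x∣ e∈D) D≡m)) ¬P
      in C , p─q⊆p D ⁅ e ⁆ ∘ C⊆ , minC

  -- Unfolds to the second conjunct of `extActive M B v` for `P = indep M`, `D = B ∪ ⁅ v ⁆`, and of
  -- `intActive M B v` for `P = coindep M`, `D = ∁ B ∪ ⁅ v ⁆`.
  smallestInMinimal : Subset n → Fin n → Bool
  smallestInMinimal D v = allL (λ C → not (isMinimalNon P C ∧ subᵇ C D) ∨
    allL (λ e → not (memᵇ e C) ∨ does (v Fin.≤? e)) (allElems n)) (allSubsets n)

  -- All minimal non-members below D pass through the same elements,
  -- as a fundamental circuit does.
  Fundamental : Subset n → Set
  Fundamental D = ∀ {C e} → C ⊆ D → P C ≢ true → e ∈ C → P (C - e) ≡ true → P (D - e) ≡ true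

  -- A minimal non-member `C ⊆ D` must contain `e`, for otherwise `C ⊆ D - e` would be a member by
  -- heredity.
  smallestInMinimal⁻ : ∀ {D v} → P D ≢ true → smallestInMinimal D v ≡ true →
                       ∀ {e} → e ∈ D → P (D - e) ≡ true → v Fin.≤ e
  smallestInMinimal⁻ {D} {v} ¬PD h {e} e∈D PD-e =
    let C , C⊆D , minC = ∃minimalNon D ¬PD
        e∈C = decidable-stable (e ∈? C) λ e∉C → proj₁ (minimalNon⁻ minC)
                (hereditary _ C (λ x∈C → x∈p∧x≢y⇒x∈p-y (C⊆D x∈C) λ { refl → e∉C x∈C }) PD-e)
        smallest = ⇒-true⁻ (allL⁻ h (∈-allSubsets C)) (∧-true⁺ minC (subᵇ⁺ C⊆D))
    in does⁻ (v Fin.≤? e) (⇒-true⁻ (allL⁻ smallest (∈-allFin e)) ([]=⇒lookup e∈C))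

  smallestInMinimal⁺ : ∀ {D v} → Fundamental D →
                       (∀ {e} → e ∈ D → P (D - e) ≡ true → v Fin.≤ e) → smallestInMinimal D v ≡ true
  smallestInMinimal⁺ {D} {v} fund h = allL⁺ (allSubsets n) λ C → ⇒-true⁺ λ hC →
    let minC , C⊆D = ∧-true⁻ {isMinimalNon P C} hC
        ¬PC , PC-e = minimalNon⁻ minC
    in allL⁺ (allFin n) λ e → ⇒-true⁺ λ e∈ → let e∈C = lookup⇒[]= e C e∈ in
      dec-true (v Fin.≤? e) (h (subᵇ⁻ C⊆D e∈C) (fund (subᵇ⁻ C⊆D) ¬PC e∈C (PC-e e∈C)))

-- Bases and ranks

module MatroidProperties {n : ℕ} (M : Matroid n) where

  Indep : Subset n → Set
  Indep X = indep M X ≡ true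

  hereditary : ∀ {X Y} → Y ⊆ X → Indep X → Indep Y
  hereditary {X} {Y} = indep-hereditary M X Y

  -- Repeated augmentation of `X` from `Y`; `d` counts the elements still to be added.
  extend : ∀ {X Y} → Indep X → Indep Y → ∀ m → ∣ X ∣ ≤ m → m ≤ ∣ Y ∣ →
           ∃[ J ] (X ⊆ J × J ⊆ X ∪ Y × Indep J × ∣ J ∣ ≡ m)
  extend {X} {Y} iX iY m X≤m m≤Y = go (m ∸ ∣ X ∣) iX (m+[n∸m]≡n X≤m)
    where
    go : ∀ d {X} → Indep X → ∣ X ∣ + d ≡ m → ∃[ J ] (X ⊆ J × J ⊆ X ∪ Y × Indep J × ∣ J ∣ ≡ m)
    go zero {X} iX eq = X , id , p⊆p∪q Y , iX , trans (sym (+-identityʳ _)) eq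
    go (suc d) {X} iX eq
      with indep-augment M X Y iX iY (<-≤-trans (m<m+n ∣ X ∣ (s≤s z≤n)) (≤-trans (≤-reflexive eq) m≤Y))
    ... | e , e∈Y , e∉X , iXe
      with go d iXe (trans (cong (_+ d) (∣p∪⁅x⁆∣ X e∉X)) (trans (sym (+-suc ∣ X ∣ d)) eq))
    ... | J , Xe⊆J , J⊆ , iJ , J≡m = J , Xe⊆J ∘ p⊆p∪q ⁅ e ⁆
        , (λ x∈J → p∪q⊆ (p∪⁅x⁆⊆ (p⊆p∪q Y) (q⊆p∪q X Y e∈Y)) (q⊆p∪q X Y) (J⊆ x∈J)) , iJ , J≡m

  rank-attained : ∀ X → ∃[ Y ] (Y ⊆ X × Indep Y × ∣ Y ∣ ≡ rank M X)
  rank-attained X = go (allSubsets n)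
    where
    go : ∀ Ys → ∃[ Y ] (Y ⊆ X × Indep Y ×
         ∣ Y ∣ ≡ foldr (λ Y r → (if subᵇ Y X ∧ indep M Y then ∣ Y ∣ else 0) ⊔ r) 0 Ys)
    -- The starting value 0 of the maximum is attained by the empty set.
    go [] = ⊥ , ⊥⊆ , indep-empty M , ∣⊥∣≡0 n
    go (Y ∷ Ys) with subᵇ Y X ∧ indep M Y in eq
    ... | false = go Ys
    ... | true with ⊔-sel ∣ Y ∣ (foldr (λ Y r → (if subᵇ Y X ∧ indep M Y then ∣ Y ∣ else 0) ⊔ r) 0 Ys)
    ... | inj₁ ≡Y = let Y⊆X , iY = ∧-true⁻ {subᵇ Y X} eq in Y , subᵇ⁻ Y⊆X , iY , sym ≡Y
    ... | inj₂ ≡r = let Z , Z⊆X , iZ , Z≡ = go Ys in Z , Z⊆X , iZ , trans Z≡ (sym ≡r)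

  indep⇒≤rank : ∀ {X Y} → Y ⊆ X → Indep Y → ∣ Y ∣ ≤ rank M X
  indep⇒≤rank {X} {Y} Y⊆X iY = go (∈-allSubsets Y)
    where
    go : ∀ {Ys} → Y ∈ₗ Ys → ∣ Y ∣ ≤ foldr (λ Y r → (if subᵇ Y X ∧ indep M Y then ∣ Y ∣ else 0) ⊔ r) 0 Ys
    go (here refl) rewrite subᵇ⁺ Y⊆X | iY = m≤m⊔n _ _
    go (there Y∈) = ≤-trans (go Y∈) (m≤n⊔m _ _)

  ∃basisOf⊇ : ∀ {I X} → I ⊆ X → Indep I → ∃[ J ] (I ⊆ J × J ⊆ X × Indep J × ∣ J ∣ ≡ rank M X)
  ∃basisOf⊇ {I} {X} I⊆X iI =
    let Y , Y⊆X , iY , Y≡ = rank-attained X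
        J , I⊆J , J⊆ , iJ , J≡ = extend iI iY (rank M X) (indep⇒≤rank I⊆X iI) (≤-reflexive (sym Y≡))
    in J , I⊆J , (λ x∈J → p∪q⊆ I⊆X Y⊆X (J⊆ x∈J)) , iJ , J≡

  rank≤ : ∀ X {m} → (∀ {Y} → Y ⊆ X → Indep Y → ∣ Y ∣ ≤ m) → rank M X ≤ m
  rank≤ X h = let Y , Y⊆X , iY , Y≡ = rank-attained X in ≤-trans (≤-reflexive (sym Y≡)) (h Y⊆X iY)

  rank-mono : ∀ {X Y} → X ⊆ Y → rank M X ≤ rank M Y
  rank-mono {X} X⊆Y = rank≤ X (λ Z⊆X → indep⇒≤rank (λ x∈Z → X⊆Y (Z⊆X x∈Z)))

  rank-∪≤ : ∀ X Y → rank M (X ∪ Y) ≤ rank M X + rank M Y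
  rank-∪≤ X Y = rank≤ (X ∪ Y) λ {Z} Z⊆ iZ → begin
    ∣ Z ∣                  ≡⟨ ∣p∣≡∣p∩q∣+∣p─q∣ Z X ⟩
    ∣ Z ∩ X ∣ + ∣ Z ─ X ∣  ≤⟨ +-mono-≤ (indep⇒≤rank (p∩q⊆q Z X) (hereditary (p∩q⊆p Z X) iZ))
                                       (indep⇒≤rank (Z─X⊆Y Z⊆) (hereditary (p─q⊆p Z X) iZ)) ⟩
    rank M X + rank M Y    ∎
    where
    open ≤-Reasoning
    Z─X⊆Y : ∀ {Z} → Z ⊆ X ∪ Y → Z ─ X ⊆ Y
    Z─X⊆Y Z⊆ x∈ with x∈p─q⁻ x∈
    ... | x∈Z , x∉X with x∈p∪q⁻ X Y (Z⊆ x∈Z)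
    ... | inj₁ x∈X = contradiction x∈X x∉X
    ... | inj₂ x∈Y = x∈Y

  rank≤∣∣ : ∀ X → rank M X ≤ ∣ X ∣
  rank≤∣∣ X = rank≤ X (λ Y⊆X _ → p⊆q⇒∣p∣≤∣q∣ Y⊆X)

  -- A larger independent subset of `X` would augment `J` by an element of `X` outside `J`.
  maximal⇒rank≤ : ∀ {J X} → Indep J → (∀ {e} → e ∈ X → Indep (J ∪ ⁅ e ⁆) → e ∈ J) → rank M X ≤ ∣ J ∣
  maximal⇒rank≤ {J} {X} iJ max = rank≤ X λ {Y} Y⊆X iY → ≮⇒≥ λ J<Y →
    let e , e∈Y , e∉J , iJe = indep-augment M J Y iJ iY J<Y in e∉J (max (Y⊆X e∈Y) iJe)

  rank≤⇒maximal : ∀ {J X e} → J ⊆ X → rank M X ≤ ∣ J ∣ → e ∈ X → Indep (J ∪ ⁅ e ⁆) → e ∈ J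
  rank≤⇒maximal {J} {X} {e} J⊆X r≤ e∈X iJe = decidable-stable (e ∈? J) λ e∉J →
    1+n≰n (≤-trans (≤-reflexive (sym (∣p∪⁅x⁆∣ J e∉J))) (≤-trans (indep⇒≤rank (p∪⁅x⁆⊆ J⊆X e∈X) iJe) r≤))

  -- Size replaces the maximality of `isBasis`, so that after an exchange only independence has to
  -- be checked.
  Basis : Subset n → Set
  Basis B = Indep B × ∣ B ∣ ≡ rank M ⊤

  isBasis⁻ : ∀ {B} → isBasis M B ≡ true → Basis B
  isBasis⁻ {B} h = let iB , h₂ = ∧-true⁻ h in iB , ≤-antisym (indep⇒≤rank {⊤} (λ _ → ∈⊤) iB)
    (maximal⇒rank≤ {B} {⊤} iB (λ {e} _ iBe → lookup⇒[]= e B (max (allL⁻ h₂ (∈-allFin e)) iBe)))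
    where
    max : ∀ {a b} → a ∨ not b ≡ true → b ≡ true → a ≡ true
    max {true} _ _ = refl
    max {false} {true} () _

  isBasis⁺ : ∀ {B} → Basis B → isBasis M B ≡ true
  isBasis⁺ {B} (iB , B≡) = ∧-true⁺ iB (allL⁺ (allFin n) λ e →
    max {memᵇ e B} (λ iBe → []=⇒lookup (rank≤⇒maximal {B} {⊤} (λ _ → ∈⊤) (≤-reflexive (sym B≡)) ∈⊤ iBe)))
    where
    max : ∀ {a b} → (b ≡ true → a ≡ true) → a ∨ not b ≡ true
    max {true} h = refl
    max {false} {true} h with () ← h refl
    max {false} {false} h = refl

  isBasis? : Decidable (λ B → isBasis M B ≡ true)
  isBasis? B = isBasis M B Bool.≟ true

  ∃basis : ∃[ B ] Basis B
  ∃basis = let B , _ , iB , B≡ = rank-attained ⊤ in B , iB , B≡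

  ∪⁅⁆-dependent : ∀ {B v} → Basis B → v ∉ B → ¬ Indep (B ∪ ⁅ v ⁆)
  ∪⁅⁆-dependent {B} (_ , B≡) v∉B iBv = v∉B (rank≤⇒maximal {B} {⊤} (λ _ → ∈⊤) (≤-reflexive (sym B≡)) ∈⊤ iBv)

  coindep⁻ : ∀ {X} → coindep M X ≡ true → ∃[ B ] (Basis B × (∀ {x} → x ∈ B → x ∉ X))
  coindep⁻ {X} h with anyL⁻ (allSubsets n) h
  ... | B , hB = let bB , B⊆ = ∧-true⁻ {isBasis M B} hB in
    B , isBasis⁻ bB , λ x∈B → x∈∁p⇒x∉p (subᵇ⁻ B⊆ x∈B)

  coindep⁺ : ∀ {B X} → Basis B → (∀ {x} → x ∈ B → x ∉ X) → coindep M X ≡ true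
  coindep⁺ {B} bB disj = anyL⁺ (∈-allSubsets B)
    (∧-true⁺ (isBasis⁺ bB) (subᵇ⁺ (λ x∈B → x∉p⇒x∈∁p (disj x∈B))))

  coindep-hereditary : ∀ X Y → Y ⊆ X → coindep M X ≡ true → coindep M Y ≡ true
  coindep-hereditary X Y Y⊆X h =
    let B , bB , disj = coindep⁻ h in coindep⁺ bB (λ x∈B x∈Y → disj x∈B (Y⊆X x∈Y))

  -- Fundamental circuits, fundamental cocircuits and activities

  module Circuits = Hereditary (indep M) (indep-hereditary M)
  module Cocircuits = Hereditary (coindep M) coindep-hereditary

  ∣exchange∣ : ∀ {B : Subset n} {v e} → v ∉ B → e ∈ B ∪ ⁅ v ⁆ → ∣ B ∪ ⁅ v ⁆ - e ∣ ≡ ∣ B ∣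
  ∣exchange∣ {B} v∉B e∈ = suc-injective (trans (∣p-x∣ e∈) (∣p∪⁅x⁆∣ B v∉B))

  -- Extend `C - e` from `B` to an independent `J` of size `∣ B ∣` inside `B ∪ ⁅ v ⁆`. It misses
  -- `e`, since otherwise it would contain `C`; by size it is all of `B ∪ ⁅ v ⁆ - e`.
  circuit-fundamental : ∀ {B v} → Basis B → v ∉ B → Circuits.Fundamental (B ∪ ⁅ v ⁆)
  circuit-fundamental {B} {v} (iB , _) v∉B {C} {e} C⊆ ¬iC e∈C iC-e =
    let J , C-e⊆J , J⊆ , iJ , J≡ = extend iC-e iB ∣ B ∣ C-e≤B ≤-refl
        C⊆J : e ∈ J → C ⊆ J
        C⊆J e∈J {x} x∈C = case-≡ (λ { refl → e∈J }) (λ x≢e → C-e⊆J (x∈p∧x≢y⇒x∈p-y x∈C x≢e))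
        J⊆D-e : J ⊆ B ∪ ⁅ v ⁆ - e
        J⊆D-e x∈J = x∈p∧x≢y⇒x∈p-y
          (p∪q⊆ (λ y∈ → C⊆ (p─q⊆p C ⁅ e ⁆ y∈)) (p⊆p∪q ⁅ v ⁆) (J⊆ x∈J))
          λ { refl → ¬iC (hereditary (C⊆J x∈J) iJ) }
    in hereditary (⊆∧∣≥∣⇒⊇ {p = J} {q = B ∪ ⁅ v ⁆ - e} J⊆D-e (≤-reflexive (trans (∣exchange∣ v∉B (C⊆ e∈C)) (sym J≡)))) iJ
    where
    case-≡ : ∀ {x} {Z : Set} → (x ≡ e → Z) → (x ≢ e → Z) → Z
    case-≡ {x} f g with x Fin.≟ e
    ... | yes eq = f eq
    ... | no neq = g neq
    C-e≤B : ∣ C - e ∣ ≤ ∣ B ∣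
    C-e≤B = s≤s⁻¹ (≤-trans (≤-reflexive (∣p-x∣ e∈C))
                  (≤-trans (p⊆q⇒∣p∣≤∣q∣ C⊆) (≤-reflexive (∣p∪⁅x⁆∣ B v∉B))))

  -- Augment `B - v` by some `f` from a basis `B′` that avoids `C - e`. If `f ≢ e`, the new basis
  -- avoids `C`, which is not coindependent. So `f` is `e`, and the new basis avoids
  -- `∁ B ∪ ⁅ v ⁆ - e`.
  cocircuit-fundamental : ∀ {B v} → Basis B → v ∈ B → Cocircuits.Fundamental (∁ B ∪ ⁅ v ⁆)
  cocircuit-fundamental {B} {v} (iB , B≡) v∈B {C} {e} C⊆ ¬cC e∈C cC-e with coindep⁻ cC-e
  ... | B′ , (iB′ , B′≡) , disj
    with indep-augment M (B - v) B′ (hereditary (p─q⊆p B ⁅ v ⁆) iB) iB′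
           (≤-reflexive (trans (∣p-x∣ v∈B) (trans B≡ (sym B′≡))))
  ... | f , f∈B′ , f∉ , i with f Fin.≟ e
  ... | no f≢e = contradiction (coindep⁺ (i , size) λ x∈ → avoids x∈) ¬cC
    where
    size : ∣ (B - v) ∪ ⁅ f ⁆ ∣ ≡ rank M ⊤
    size = trans (∣p∪⁅x⁆∣ (B - v) f∉) (trans (∣p-x∣ v∈B) B≡)
    avoids : ∀ {x} → x ∈ (B - v) ∪ ⁅ f ⁆ → x ∉ C
    avoids x∈ x∈C with x∈p∪⁅y⁆⁻ x∈
    ... | inj₂ refl = disj f∈B′ (x∈p∧x≢y⇒x∈p-y x∈C f≢e)
    ... | inj₁ x∈B-v with x∈p∪⁅y⁆⁻ (C⊆ x∈C)
    ... | inj₁ x∈∁B = x∈∁p⇒x∉p x∈∁B (p─q⊆p B ⁅ v ⁆ x∈B-v)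
    ... | inj₂ refl = x∉p-x x∈B-v
  ... | yes refl = coindep⁺ (i , size) λ x∈ → avoids x∈
    where
    size : ∣ (B - v) ∪ ⁅ e ⁆ ∣ ≡ rank M ⊤
    size = trans (∣p∪⁅x⁆∣ (B - v) f∉) (trans (∣p-x∣ v∈B) B≡)
    avoids : ∀ {x} → x ∈ (B - v) ∪ ⁅ e ⁆ → x ∉ ∁ B ∪ ⁅ v ⁆ - e
    avoids x∈ x∈C with x∈p-y⁻ x∈C | x∈p∪⁅y⁆⁻ x∈
    ... | _ , x≢e | inj₂ refl = x≢e refl
    ... | x∈D , _ | inj₁ x∈B-v with x∈p∪⁅y⁆⁻ x∈D
    ... | inj₁ x∈∁B = x∈∁p⇒x∉p x∈∁B (p─q⊆p B ⁅ v ⁆ x∈B-v)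
    ... | inj₂ refl = x∉p-x x∈B-v

  -- Activity in terms of exchanges: apart from `v`, the circuit in `B ∪ ⁅ v ⁆` consists of the
  -- `e ∈ B` that `v` can replace. In this form it can be compared with weights.
  extActive⁻ : ∀ {B v} → Basis B → extActive M B v ≡ true →
               v ∉ B × (∀ {e} → e ∈ B → Indep (B ∪ ⁅ v ⁆ - e) → v Fin.≤ e)
  extActive⁻ {B} {v} bB h =
    let v∉ , h₂ = ∧-true⁻ {not (memᵇ v B)} h
        v∉B = λ v∈B → not-true⁻ v∉ ([]=⇒lookup v∈B)
    in v∉B , λ e∈B → Circuits.smallestInMinimal⁻ (∪⁅⁆-dependent bB v∉B) h₂ (p⊆p∪q ⁅ v ⁆ e∈B)

  extActive⁺ : ∀ {B v} → Basis B → v ∉ B →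
               (∀ {e} → e ∈ B → Indep (B ∪ ⁅ v ⁆ - e) → v Fin.≤ e) → extActive M B v ≡ true
  extActive⁺ {B} {v} bB v∉B h = ∧-true⁺ (not-true⁺ (λ v∈ → v∉B (lookup⇒[]= v B v∈)))
    (Circuits.smallestInMinimal⁺ (circuit-fundamental bB v∉B) λ e∈ → smallest e∈)
    where
    smallest : ∀ {e} → e ∈ B ∪ ⁅ v ⁆ → Indep (B ∪ ⁅ v ⁆ - e) → v Fin.≤ e
    smallest e∈ with x∈p∪⁅y⁆⁻ e∈
    ... | inj₁ e∈B = h e∈B
    ... | inj₂ refl = λ _ → ≤-refl

  module _ {B v e} (bB : Basis B) (v∈B : v ∈ B) (e∉B : e ∉ B) where

    -- A basis avoiding `∁ B ∪ ⁅ v ⁆ - e` lies in `B ∪ ⁅ e ⁆ - v`, and the sizes agree.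
    coindep⇒exchange : coindep M (∁ B ∪ ⁅ v ⁆ - e) ≡ true → Indep (B ∪ ⁅ e ⁆ - v)
    coindep⇒exchange c =
      let B′ , (iB′ , B′≡) , disj = coindep⁻ c
      in hereditary (⊆∧∣≥∣⇒⊇ {p = B′} {q = B ∪ ⁅ e ⁆ - v} (λ x∈ → B′⊆ disj x∈) (≤-reflexive
           (trans (∣exchange∣ e∉B (p⊆p∪q ⁅ e ⁆ v∈B)) (trans (proj₂ bB) (sym B′≡))))) iB′
      where
      B′⊆ : ∀ {B′} → (∀ {x} → x ∈ B′ → x ∉ ∁ B ∪ ⁅ v ⁆ - e) → B′ ⊆ B ∪ ⁅ e ⁆ - v
      B′⊆ disj {x} x∈ with x Fin.≟ e
      ... | yes refl = x∈p∧x≢y⇒x∈p-y x∈p∪⁅x⁆ λ { refl → e∉B v∈B }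
      ... | no x≢e = x∈p∧x≢y⇒x∈p-y
        (p⊆p∪q ⁅ e ⁆ (decidable-stable (x ∈? B) λ x∉B →
          disj x∈ (x∈p∧x≢y⇒x∈p-y (p⊆p∪q ⁅ v ⁆ (x∉p⇒x∈∁p x∉B)) x≢e)))
        λ { refl → disj x∈ (x∈p∧x≢y⇒x∈p-y x∈p∪⁅x⁆ x≢e) }

    exchange⇒coindep : Indep (B ∪ ⁅ e ⁆ - v) → coindep M (∁ B ∪ ⁅ v ⁆ - e) ≡ true
    exchange⇒coindep i = coindep⁺ (i , trans (∣exchange∣ e∉B (p⊆p∪q ⁅ e ⁆ v∈B)) (proj₂ bB)) λ x∈ → disj x∈
      where
      disj : ∀ {x} → x ∈ B ∪ ⁅ e ⁆ - v → x ∉ ∁ B ∪ ⁅ v ⁆ - e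
      disj x∈ x∈′ with x∈p-y⁻ x∈ | x∈p-y⁻ x∈′
      ... | x∈Be , x≢v | x∈∁Bv , x≢e with x∈p∪⁅y⁆⁻ x∈Be | x∈p∪⁅y⁆⁻ x∈∁Bv
      ... | inj₂ x≡e | _ = x≢e x≡e
      ... | inj₁ _ | inj₂ x≡v = x≢v x≡v
      ... | inj₁ x∈B | inj₁ x∈∁B = x∈∁p⇒x∉p x∈∁B x∈B

  -- The dual form: apart from `v`, the cocircuit in `∁ B ∪ ⁅ v ⁆` consists of the `e ∉ B` that can
  -- replace `v`.
  intActive⁻ : ∀ {B v} → Basis B → intActive M B v ≡ true →
               v ∈ B × (∀ {e} → e ∉ B → Indep (B ∪ ⁅ e ⁆ - v) → v Fin.≤ e)
  intActive⁻ {B} {v} bB h =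
    let v∈ , h₂ = ∧-true⁻ {memᵇ v B} h
        v∈B = lookup⇒[]= v B v∈
    in v∈B , λ e∉B i → Cocircuits.smallestInMinimal⁻ (dependent v∈B) h₂
                         (p⊆p∪q ⁅ v ⁆ (x∉p⇒x∈∁p e∉B)) (exchange⇒coindep bB v∈B e∉B i)
    where
    -- A basis avoiding this set would lie in `B`, hence equal `B` and contain `v`.
    dependent : v ∈ B → coindep M (∁ B ∪ ⁅ v ⁆) ≢ true
    dependent v∈B c = let B′ , (_ , B′≡) , disj = coindep⁻ c in
      disj (⊆∧∣≥∣⇒⊇ {p = B′} {q = B} (λ x∈ → B′⊆B disj x∈) (≤-reflexive (trans (proj₂ bB) (sym B′≡))) v∈B) x∈p∪⁅x⁆
      where
      B′⊆B : ∀ {B′} → (∀ {x} → x ∈ B′ → x ∉ ∁ B ∪ ⁅ v ⁆) → B′ ⊆ B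
      B′⊆B disj {x} x∈ = decidable-stable (x ∈? B) λ x∉B → disj x∈ (p⊆p∪q ⁅ v ⁆ (x∉p⇒x∈∁p x∉B))

  intActive⁺ : ∀ {B v} → Basis B → v ∈ B →
               (∀ {e} → e ∉ B → Indep (B ∪ ⁅ e ⁆ - v) → v Fin.≤ e) → intActive M B v ≡ true
  intActive⁺ {B} {v} bB v∈B h = ∧-true⁺ ([]=⇒lookup v∈B)
    (Cocircuits.smallestInMinimal⁺ (cocircuit-fundamental bB v∈B) λ e∈ → smallest e∈)
    where
    smallest : ∀ {e} → e ∈ ∁ B ∪ ⁅ v ⁆ → coindep M (∁ B ∪ ⁅ v ⁆ - e) ≡ true → v Fin.≤ e
    smallest e∈ with x∈p∪⁅y⁆⁻ e∈
    ... | inj₁ e∈∁B = λ c → let e∉B = x∈∁p⇒x∉p e∈∁B in h e∉B (coindep⇒exchange bB v∈B e∉B c)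
    ... | inj₂ refl = λ _ → ≤-refl

  -- Optimal bases

  -- Only single exchanges are tested; for injective weights this already determines the basis.
  Optimal : (Fin n → ℕ) → Subset n → Set
  Optimal w B = ∀ {v e} → v ∉ B → e ∈ B → Indep (B ∪ ⁅ v ⁆ - e) → w v ≤ w e

  -- In a basis of largest total weight no exchange can gain, and exchanging `e` for `v` changes the
  -- total by `w v` minus `w e`.
  ∃optimal : ∀ w → ∃[ B ] (Basis B × Optimal w B)
  ∃optimal w =
    let B₀ , bB₀ = ∃basis
        B , bB , max = maximiser isBasis? (weight w) (allSubsets n) (isBasis⁺ bB₀)
    in B , isBasis⁻ bB , λ {v} {e} v∉B e∈B i →
      let B′ = B ∪ ⁅ v ⁆ - e
          e∈ = p⊆p∪q ⁅ v ⁆ e∈B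
          bB′ = i , trans (∣exchange∣ v∉B e∈) (proj₂ (isBasis⁻ bB))
      in +-cancelʳ-≤ (weight w B) (w v) (w e) (begin
        w v + weight w B    ≡⟨ sym (weight-∪⁅⁆ w B v∉B) ⟩
        weight w (B ∪ ⁅ v ⁆) ≡⟨ sym (weight-minus w e∈) ⟩
        w e + weight w B′   ≤⟨ +-monoʳ-≤ (w e) (max (∈-allSubsets B′) (isBasis⁺ bB′)) ⟩
        w e + weight w B    ∎)
    where open ≤-Reasoning

  -- The circuit in `B ∪ ⁅ f ⁆` is not contained in the independent set `Y`. Any of its elements
  -- outside `Y` can serve as `g`; it is not `f`, since `f ∈ Y`.
  exchange : ∀ {B Y f} → Basis B → Indep Y → f ∈ Y → f ∉ B →
             ∃[ g ] (g ∈ B × g ∉ Y × Indep (B ∪ ⁅ f ⁆ - g))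
  exchange {B} {Y} {f} bB iY f∈Y f∉B
    with Circuits.∃minimalNon (B ∪ ⁅ f ⁆) (∪⁅⁆-dependent bB f∉B)
  ... | C , C⊆ , minC with Circuits.minimalNon⁻ minC
  ... | ¬iC , iC-e with Fin.any? (λ g → (g ∈? C) ×-dec ¬? (g ∈? Y))
  ... | no ∄ = contradiction
    (hereditary (λ {x} x∈C → decidable-stable (x ∈? Y) λ x∉Y → ∄ (x , x∈C , x∉Y)) iY) ¬iC
  ... | yes (g , g∈C , g∉Y) = g , g∈B , g∉Y , circuit-fundamental bB f∉B C⊆ ¬iC g∈C (iC-e g∈C)
    where
    g∈B : g ∈ B
    g∈B with x∈p∪⁅y⁆⁻ (C⊆ g∈C)
    ... | inj₁ g∈B = g∈B
    ... | inj₂ refl = contradiction f∈Y g∉Y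

  -- A disagreement of largest weight could be exchanged into the basis that misses it.
  optimal-unique : ∀ {w B B′} → (∀ {x y} → w x ≡ w y → x ≡ y) →
                   Basis B → Basis B′ → Optimal w B → Optimal w B′ → B ≡ B′
  optimal-unique {w} {B} {B′} inj bB bB′ oB oB′
    with Fin.any? (λ x → (x ∈? B) ×-dec ¬? (x ∈? B′))
  ... | no ∄ = ⊆-antisym B⊆B′ (⊆∧∣≥∣⇒⊇ B⊆B′ (≤-reflexive (trans (proj₂ bB′) (sym (proj₂ bB)))))
    where
    B⊆B′ : B ⊆ B′
    B⊆B′ {x} x∈B = decidable-stable (x ∈? B′) λ x∉B′ → ∄ (x , x∈B , x∉B′)
  ... | yes (x , x∈B , x∉B′) = contradiction (proj₁ (proj₂ heaviest)) (disagree (proj₂ (proj₂ heaviest)))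
    where
    Differ : Fin n → Set
    Differ x = (x ∈ B × x ∉ B′) ⊎ (x ∈ B′ × x ∉ B)

    Differ? : Decidable Differ
    Differ? x = ((x ∈? B) ×-dec ¬? (x ∈? B′)) ⊎-dec ((x ∈? B′) ×-dec ¬? (x ∈? B))

    heaviest : ∃[ f ] (Differ f × (∀ {y} → y ∈ₗ allFin n → Differ y → w y ≤ w f))
    heaviest = maximiser Differ? w (allFin n) (inj₁ (x∈B , x∉B′))

    disagree : ∀ {f} → (∀ {y} → y ∈ₗ allFin n → Differ y → w y ≤ w f) → ¬ Differ f
    -- Optimality of `B′` gives `w f ≤ w g` and the choice of `f` the converse, so `f ≡ g` by
    -- injectivity.
    disagree max (inj₁ (f∈B , f∉B′)) =
      let g , g∈B′ , g∉B , i = exchange bB′ (proj₁ bB) f∈B f∉B′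
          f≡g = inj (≤-antisym (oB′ f∉B′ g∈B′ i) (max (∈-allFin g) (inj₂ (g∈B′ , g∉B))))
      in f∉B′ (subst (_∈ B′) (sym f≡g) g∈B′)
    disagree max (inj₂ (f∈B′ , f∉B)) =
      let g , g∈B , g∉B′ , i = exchange bB (proj₁ bB′) f∈B′ f∉B
          f≡g = inj (≤-antisym (oB f∉B g∈B i) (max (∈-allFin g) (inj₁ (g∈B , g∉B′))))
      in f∉B (subst (_∈ B) (sym f≡g) g∈B)

  -- Crapo's intervals

  -- B − IA(B) ⊆ A ⊆ B ∪ EA(B).
  record Interval (B A : Subset n) : Set where
    constructor interval
    field
      lower : ∀ {v} → v ∈ B → v ∉ A → intActive M B v ≡ true
      upper : ∀ {v} → v ∉ B → v ∈ A → extActive M B v ≡ true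

  -- The `suc` keeps all weights outside `A` below `n`, while those inside are at least `n`.
  crapoWeight : Subset n → Fin n → ℕ
  crapoWeight A x with x ∈? A
  ... | yes _ = n + toℕ x
  ... | no _ = n ∸ suc (toℕ x)

  outside<inside : ∀ (x y : Fin n) → n ∸ suc (toℕ x) < n + toℕ y
  outside<inside x y = <-≤-trans (∸-monoʳ-< {n} {suc (toℕ x)} {0} (s≤s z≤n) (Fin.toℕ<n x)) (m≤m+n n (toℕ y))

  crapoWeight-injective : ∀ {A x y} → crapoWeight A x ≡ crapoWeight A y → x ≡ y
  crapoWeight-injective {A} {x} {y} eq with x ∈? A | y ∈? A
  ... | yes x∈A | yes y∈A = Fin.toℕ-injective (+-cancelˡ-≡ n _ _ eq)
  ... | no x∉A | no y∉A =
    Fin.toℕ-injective (suc-injective (∸-cancelˡ-≡ (Fin.toℕ<n x) (Fin.toℕ<n y) eq))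
  ... | yes x∈A | no y∉A = contradiction (sym eq) (<⇒≢ (outside<inside y x))
  ... | no x∉A | yes y∈A = contradiction eq (<⇒≢ (outside<inside x y))

  module _ {A B : Subset n} (bB : Basis B) where

    -- If both elements lie in `A`, then `v` is externally active, so `v` precedes `e` and weighs
    -- less. If both lie outside, then `e` is internally active and precedes `v`, and there the
    -- earlier element is heavier.
    interval⇒optimal : Interval B A → Optimal (crapoWeight A) B
    interval⇒optimal (interval ints exts) {v} {e} v∉B e∈B i with v ∈? A | e ∈? A
    ... | yes v∈A | yes e∈A = +-monoʳ-≤ n (proj₂ (extActive⁻ bB (exts v∉B v∈A)) e∈B i)
    ... | no v∉A | yes e∈A = <⇒≤ (outside<inside v e)
    ... | no v∉A | no e∉A = ∸-monoʳ-≤ n (s≤s (proj₂ (intActive⁻ bB (ints e∈B e∉A)) v∉B i))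
    -- Here `v` is externally and `e` internally active, so each precedes the other and they
    -- coincide, although only `e` is in `B`.
    ... | yes v∈A | no e∉A = contradiction
      (Fin.≤-antisym (proj₂ (extActive⁻ bB (exts v∉B v∈A)) e∈B i) (proj₂ (intActive⁻ bB (ints e∈B e∉A)) v∉B i))
      λ { refl → v∉B e∈B }

    -- An element that can replace `v ∈ B` weighs no more than `v`; if `v ∉ A`, it is therefore also
    -- outside `A` and not before `v`. For `v ∉ B` in `A`, the elements that `v` can replace are
    -- likewise in `A` and not before `v`.
    optimal⇒interval : Optimal (crapoWeight A) B → Interval B A
    optimal⇒interval opt = interval
      (λ v∈B v∉A → intActive⁺ bB v∈B λ e∉B i → outside v∉A (opt e∉B v∈B i))
      (λ v∉B v∈A → extActive⁺ bB v∉B λ e∈B i → inside v∈A (opt v∉B e∈B i))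
      where
      outside : ∀ {v e} → v ∉ A → crapoWeight A e ≤ crapoWeight A v → v Fin.≤ e
      outside {v} {e} v∉A h with v ∈? A | e ∈? A
      ... | yes v∈A | _ = contradiction v∈A v∉A
      ... | no _ | no e∉A = ≮⇒≥ λ e<v → contradiction h (<⇒≱ (∸-monoʳ-< (s≤s e<v) (Fin.toℕ<n v)))
      ... | no _ | yes e∈A = contradiction h (<⇒≱ (outside<inside v e))
      inside : ∀ {v e} → v ∈ A → crapoWeight A v ≤ crapoWeight A e → v Fin.≤ e
      inside {v} {e} v∈A h with v ∈? A | e ∈? A
      ... | no v∉A | _ = contradiction v∈A v∉A
      ... | yes _ | yes e∈A = +-cancelˡ-≤ n _ _ h
      ... | yes _ | no e∉A = contradiction h (<⇒≱ (outside<inside e v))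

  crapoWeight-∉<∈ : ∀ {A x y} → x ∉ A → y ∈ A → crapoWeight A x < crapoWeight A y
  crapoWeight-∉<∈ {A} {x} {y} x∉A y∈A with x ∈? A | y ∈? A
  ... | yes x∈A | _ = contradiction x∈A x∉A
  ... | no _ | no y∉A = contradiction y∈A y∉A
  ... | no _ | yes _ = outside<inside x y

  -- `B ∩ A` is maximal independent in `A`. If `e ∈ A` outside `B` could be added to it, extending
  -- the result from `B` to a basis inside `B ∪ ⁅ e ⁆` would drop some `g ∈ B` outside `A`; but `e`
  -- outweighs `g`, against optimality.
  interval-rank : ∀ {A B} → Basis B → Interval B A → rank M A ≡ ∣ B ∩ A ∣
  interval-rank {A} {B} bB@(iB , B≡) ivl = ≤-antisym
    (maximal⇒rank≤ {B ∩ A} {A} i∩ λ e∈A i → x∈p∩q⁺ (e∈B e∈A i , e∈A))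
    (indep⇒≤rank (p∩q⊆q B A) i∩)
    where
    i∩ : Indep (B ∩ A)
    i∩ = hereditary (p∩q⊆p B A) iB
    e∈B : ∀ {e} → e ∈ A → Indep ((B ∩ A) ∪ ⁅ e ⁆) → e ∈ B
    e∈B {e} e∈A i with e ∈? B
    ... | yes e∈B = e∈B
    ... | no e∉B with extend i iB ∣ B ∣ (≤-trans (indep⇒≤rank {⊤} (λ _ → ∈⊤) i) (≤-reflexive (sym B≡))) ≤-refl
    ... | J , ⊆J , J⊆ , iJ , J≡
      with ∣p∣<∣q∣⇒∃ {p = J} {q = B ∪ ⁅ e ⁆} (≤-reflexive (trans (cong suc J≡) (sym (∣p∪⁅x⁆∣ B e∉B))))
    ... | g , g∈Be , g∉J = contradiction (interval⇒optimal bB ivl e∉B g∈B iBe-g)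
      (<⇒≱ (crapoWeight-∉<∈ g∉A e∈A))
      where
      g∈B : g ∈ B
      g∈B with x∈p∪⁅y⁆⁻ g∈Be
      ... | inj₁ g∈B = g∈B
      ... | inj₂ refl = contradiction (⊆J x∈p∪⁅x⁆) g∉J
      g∉A : g ∉ A
      g∉A g∈A = g∉J (⊆J (p⊆p∪q ⁅ e ⁆ (x∈p∩q⁺ (g∈B , g∈A))))
      J⊆Be-g : J ⊆ B ∪ ⁅ e ⁆ - g
      J⊆Be-g x∈J = x∈p∧x≢y⇒x∈p-y
        (p∪q⊆ (p∪⁅x⁆⊆ (λ y∈ → p⊆p∪q ⁅ e ⁆ (p∩q⊆p B A y∈)) x∈p∪⁅x⁆) (p⊆p∪q ⁅ e ⁆) (J⊆ x∈J))
        λ { refl → g∉J x∈J }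
      iBe-g : Indep (B ∪ ⁅ e ⁆ - g)
      iBe-g = hereditary (⊆∧∣≥∣⇒⊇ {p = J} {q = B ∪ ⁅ e ⁆ - g} J⊆Be-g
        (≤-reflexive (trans (∣exchange∣ e∉B g∈Be) (sym J≡)))) iJ

  -- Large sets

  -- Stated additively to avoid truncated subtraction.
  record Large (k l : ℕ) (A : Subset n) : Set where
    constructor _,_
    field
      corank≥ : rank M A + k ≤ rank M ⊤
      nullity≥ : rank M A + l ≤ ∣ A ∣

  Large? : ∀ k l → Decidable (Large k l)
  Large? k l A = map′ (λ (c , d) → c , d) (λ (c , d) → c , d) ((rank M A + k ≤? rank M ⊤) ×-dec (rank M A + l ≤? ∣ A ∣))

  AtMostOneLarge : ℕ → ℕ → Set
  AtMostOneLarge k l = ∀ {A A′} → Large k l A → Large k l A′ → A ≡ A′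

  Large-mono : ∀ {k k′ l l′ A} → k ≤ k′ → l ≤ l′ → Large k′ l′ A → Large k l A
  Large-mono {A = A} k≤ l≤ (c , d) =
    ≤-trans (+-monoʳ-≤ (rank M A) k≤) c , ≤-trans (+-monoʳ-≤ (rank M A) l≤) d

  rank-∪⁅⁆≤ : ∀ A e → rank M (A ∪ ⁅ e ⁆) ≤ suc (rank M A)
  rank-∪⁅⁆≤ A e = begin
    rank M (A ∪ ⁅ e ⁆)        ≤⟨ rank-∪≤ A ⁅ e ⁆ ⟩
    rank M A + rank M ⁅ e ⁆   ≤⟨ +-monoʳ-≤ (rank M A) (rank≤∣∣ ⁅ e ⁆) ⟩
    rank M A + ∣ ⁅ e ⁆ ∣      ≡⟨ cong (rank M A +_) (∣⁅x⁆∣≡1 e) ⟩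
    rank M A + 1              ≡⟨ +-comm (rank M A) 1 ⟩
    suc (rank M A)            ∎
    where open ≤-Reasoning

  -- With corank to spare, adding any `e ∉ A` gives a second large set: the rank grows by at most
  -- one and the nullity does not drop. Such `e` exists, as the full set has corank 0.
  atMostOneLarge⇒¬Large-suc-k : ∀ {k l A} → AtMostOneLarge k l → ¬ Large (suc k) l A
  atMostOneLarge⇒¬Large-suc-k {k} {l} {A} unique (c , d) with Fin.any? (λ e → ¬? (e ∈? A))
  ... | no ∄ = contradiction
    (rank-mono {⊤} {A} (λ {x} _ → decidable-stable (x ∈? A) (λ x∉A → ∄ (x , x∉A))))
    (<⇒≱ (<-≤-trans (m<m+n (rank M A) (s≤s z≤n)) c))
  ... | yes (e , e∉A) = e∉A (subst (e ∈_) (unique (c′ , d′) (Large-mono (n≤1+n k) ≤-refl (c , d))) (x∈p∪⁅x⁆ {p = A}))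
    where
    open ≤-Reasoning
    c′ : rank M (A ∪ ⁅ e ⁆) + k ≤ rank M ⊤
    c′ = begin
      rank M (A ∪ ⁅ e ⁆) + k ≤⟨ +-monoˡ-≤ k (rank-∪⁅⁆≤ A e) ⟩
      suc (rank M A + k)     ≡⟨ sym (+-suc (rank M A) k) ⟩
      rank M A + suc k       ≤⟨ c ⟩
      rank M ⊤               ∎
    d′ : rank M (A ∪ ⁅ e ⁆) + l ≤ ∣ A ∪ ⁅ e ⁆ ∣
    d′ = begin
      rank M (A ∪ ⁅ e ⁆) + l ≤⟨ +-monoˡ-≤ l (rank-∪⁅⁆≤ A e) ⟩
      suc (rank M A + l)     ≤⟨ s≤s d ⟩
      suc ∣ A ∣              ≡⟨ sym (∣p∪⁅x⁆∣ A e∉A) ⟩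
      ∣ A ∪ ⁅ e ⁆ ∣          ∎

  -- Dually, with nullity to spare an element can be removed; `A` is nonempty because its nullity is
  -- positive.
  atMostOneLarge⇒¬Large-suc-l : ∀ {k l A} → AtMostOneLarge k l → ¬ Large k (suc l) A
  atMostOneLarge⇒¬Large-suc-l {k} {l} {A} unique (c , d) =
    let e , e∈A , _ = ∣p∣<∣q∣⇒∃ {p = ⊥} {q = A} (≤-trans (≤-reflexive (cong suc (∣⊥∣≡0 n))) 1≤A)
        r≤ = rank-mono {A - e} {A} (p─q⊆p A ⁅ e ⁆)
        c′ = ≤-trans (+-monoˡ-≤ k r≤) c
        d′ = s≤s⁻¹ (begin
          suc (rank M (A - e) + l) ≤⟨ s≤s (+-monoˡ-≤ l r≤) ⟩
          suc (rank M A + l)       ≡⟨ sym (+-suc (rank M A) l) ⟩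
          rank M A + suc l         ≤⟨ d ⟩
          ∣ A ∣                    ≡⟨ sym (∣p-x∣ e∈A) ⟩
          suc ∣ A - e ∣            ∎)
    in x∉p-x {p = A} (subst (e ∈_) (unique (Large-mono ≤-refl (n≤1+n l) (c , d)) (c′ , d′)) e∈A)
    where
    open ≤-Reasoning
    1≤A : 1 ≤ ∣ A ∣
    1≤A = ≤-trans (s≤s z≤n) (≤-trans (≤-reflexive (sym (+-suc (rank M A) l))) d)

  -- Large sets and the Tutte polynomial

  IA EA corner : Subset n → Subset n
  IA B = tabulate (intActive M B)
  EA B = tabulate (extActive M B)
  corner B = (B ─ IA B) ∪ EA B

  module _ (B : Subset n) where

    ∈IA⁻ : ∀ {x} → x ∈ IA B → intActive M B x ≡ true
    ∈IA⁻ {x} x∈ = trans (sym (lookup∘tabulate (intActive M B) x)) ([]=⇒lookup x∈)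

    ∈IA⁺ : ∀ {x} → intActive M B x ≡ true → x ∈ IA B
    ∈IA⁺ {x} h = lookup⇒[]= x (IA B) (trans (lookup∘tabulate (intActive M B) x) h)

    ∈EA⁻ : ∀ {x} → x ∈ EA B → extActive M B x ≡ true
    ∈EA⁻ {x} x∈ = trans (sym (lookup∘tabulate (extActive M B) x)) ([]=⇒lookup x∈)

    ∈EA⁺ : ∀ {x} → extActive M B x ≡ true → x ∈ EA B
    ∈EA⁺ {x} h = lookup⇒[]= x (EA B) (trans (lookup∘tabulate (extActive M B) x) h)

    int≡∣IA∣ : int M B ≡ ∣ IA B ∣
    int≡∣IA∣ = countL-tabulate (intActive M B) id

    ext≡∣EA∣ : ext M B ≡ ∣ EA B ∣
    ext≡∣EA∣ = countL-tabulate (extActive M B) id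

    corner-interval : Interval B (corner B)
    corner-interval = interval int∈ ext∈
      where
      int∈ : ∀ {v} → v ∈ B → v ∉ corner B → intActive M B v ≡ true
      int∈ {v} v∈B v∉ = ∈IA⁻ (decidable-stable (v ∈? IA B) λ v∉IA →
        v∉ (p⊆p∪q (EA B) (x∈p∧x∉q⇒x∈p─q v∈B v∉IA)))
      ext∈ : ∀ {v} → v ∉ B → v ∈ corner B → extActive M B v ≡ true
      ext∈ v∉B v∈ with x∈p∪q⁻ (B ─ IA B) (EA B) v∈
      ... | inj₁ v∈B─ = contradiction (p─q⊆p B (IA B) v∈B─) v∉B
      ... | inj₂ v∈EA = ∈EA⁻ v∈EA

  interval-B─A⊆IA : ∀ {A B} → Interval B A → B ─ A ⊆ IA B
  interval-B─A⊆IA {A} {B} (interval int∈ _) x∈ = let x∈B , x∉A = x∈p─q⁻ x∈ in ∈IA⁺ B (int∈ x∈B x∉A)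

  interval-A─B⊆EA : ∀ {A B} → Interval B A → A ─ B ⊆ EA B
  interval-A─B⊆EA {A} {B} (interval _ ext∈) x∈ = let x∈A , x∉B = x∈p─q⁻ x∈ in ∈EA⁺ B (ext∈ x∉B x∈A)

  -- Since `rank M A` is `∣ B ∩ A ∣`, splitting `B` along `A` gives the corank and splitting `A`
  -- along `B` the nullity.
  interval-corank : ∀ {A B} → Basis B → Interval B A → rank M ⊤ ≡ rank M A + ∣ B ─ A ∣
  interval-corank {A} {B} bB int = trans (sym (proj₂ bB)) (trans (∣p∣≡∣p∩q∣+∣p─q∣ B A)
    (cong (_+ ∣ B ─ A ∣) (sym (interval-rank bB int))))

  interval-nullity : ∀ {A B} → Basis B → Interval B A → ∣ A ∣ ≡ rank M A + ∣ A ─ B ∣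
  interval-nullity {A} {B} bB int = trans (∣p∣≡∣p∩q∣+∣p─q∣ A B)
    (cong (_+ ∣ A ─ B ∣) (trans (cong ∣_∣ (∩-comm A B)) (sym (interval-rank bB int))))

  corner-large : ∀ {B} → Basis B → Large (int M B) (ext M B) (corner B)
  corner-large {B} bB =
      ≤-trans (+-monoʳ-≤ r (≤-trans (≤-reflexive (int≡∣IA∣ B)) (p⊆q⇒∣p∣≤∣q∣ IA⊆)))
              (≤-reflexive (sym (interval-corank bB (corner-interval B))))
    , ≤-trans (+-monoʳ-≤ r (≤-trans (≤-reflexive (ext≡∣EA∣ B)) (p⊆q⇒∣p∣≤∣q∣ EA⊆)))
              (≤-reflexive (sym (interval-nullity bB (corner-interval B))))
    where
    r : ℕ
    r = rank M (corner B)
    IA⊆ : IA B ⊆ B ─ corner B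
    IA⊆ {x} x∈IA = x∈p∧x∉q⇒x∈p─q x∈B x∉corner
      where
      x∈B : x ∈ B
      x∈B = proj₁ (intActive⁻ bB (∈IA⁻ B x∈IA))
      x∉corner : x ∉ corner B
      x∉corner x∈ with x∈p∪q⁻ (B ─ IA B) (EA B) x∈
      ... | inj₁ x∈B─IA = proj₂ (x∈p─q⁻ x∈B─IA) x∈IA
      ... | inj₂ x∈EA = proj₁ (extActive⁻ bB (∈EA⁻ B x∈EA)) x∈B
    EA⊆ : EA B ⊆ corner B ─ B
    EA⊆ x∈EA = x∈p∧x∉q⇒x∈p─q (q⊆p∪q (B ─ IA B) (EA B) x∈EA) (proj₁ (extActive⁻ bB (∈EA⁻ B x∈EA)))

  -- By size the inclusions of `B ─ A` in `IA B` and of `A ─ B` in `EA B` are equalities, and these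
  -- two differences determine `A`.
  interval≡corner : ∀ {A B} → Basis B → Interval B A → int M B ≤ ∣ B ─ A ∣ → ext M B ≤ ∣ A ─ B ∣ → A ≡ corner B
  interval≡corner {A} {B} bB int i≤ e≤ = ⊆-antisym to from
    where
    IA⊆ : IA B ⊆ B ─ A
    IA⊆ = ⊆∧∣≥∣⇒⊇ (interval-B─A⊆IA int) (≤-trans (≤-reflexive (sym (int≡∣IA∣ B))) i≤)
    EA⊆ : EA B ⊆ A ─ B
    EA⊆ = ⊆∧∣≥∣⇒⊇ (interval-A─B⊆EA int) (≤-trans (≤-reflexive (sym (ext≡∣EA∣ B))) e≤)
    to : A ⊆ corner B
    to {x} x∈A with x ∈? B
    ... | yes x∈B = p⊆p∪q (EA B) (x∈p∧x∉q⇒x∈p─q x∈B λ x∈IA → proj₂ (x∈p─q⁻ (IA⊆ x∈IA)) x∈A)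
    ... | no x∉B = q⊆p∪q (B ─ IA B) (EA B) (interval-A─B⊆EA int (x∈p∧x∉q⇒x∈p─q x∈A x∉B))
    from : corner B ⊆ A
    from {x} x∈ with x∈p∪q⁻ (B ─ IA B) (EA B) x∈
    ... | inj₂ x∈EA = proj₁ (x∈p─q⁻ (EA⊆ x∈EA))
    ... | inj₁ x∈B─IA = let x∈B , x∉IA = x∈p─q⁻ x∈B─IA in
      decidable-stable (x ∈? A) λ x∉A → x∉IA (interval-B─A⊆IA int (x∈p∧x∉q⇒x∈p─q x∈B x∉A))

  Counted : ℕ → ℕ → Subset n → Set
  Counted i j B = isBasis M B ∧ (int M B ≡ᵇ i) ∧ (ext M B ≡ᵇ j) ≡ true

  counted⁻ : ∀ {i j} B → Counted i j B → Basis B × int M B ≡ i × ext M B ≡ j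
  counted⁻ {i} {j} B h =
    let bB , h₂ = ∧-true⁻ {isBasis M B} h
        int≡ , ext≡ = ∧-true⁻ {int M B ≡ᵇ i} h₂
    in isBasis⁻ bB , ≡ᵇ⇒≡ _ _ (Equivalence.from Bool.T-≡ int≡) , ≡ᵇ⇒≡ _ _ (Equivalence.from Bool.T-≡ ext≡)

  counted⁺ : ∀ {B} → Basis B → Counted (int M B) (ext M B) B
  counted⁺ {B} bB = ∧-true⁺ (isBasis⁺ bB) (∧-true⁺
    (Equivalence.to Bool.T-≡ (≡⇒≡ᵇ (int M B) _ refl)) (Equivalence.to Bool.T-≡ (≡⇒≡ᵇ (ext M B) _ refl)))

  TutteBound : ℕ → ℕ → Set
  TutteBound k l = tutteCoeff M k l ≤ 1 × (∀ i j → (i , j) >₂ (k , l) → tutteCoeff M i j ≡ 0)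

  counted⇒large : ∀ {i j} B → Counted i j B → Large i j (corner B)
  counted⇒large B h = let bB , int≡ , ext≡ = counted⁻ B h in
    Large-mono (≤-reflexive (sym int≡)) (≤-reflexive (sym ext≡)) (corner-large bB)

  -- Two bases counted by `tutteCoeff M k l` have large corners, hence the same corner, which lies
  -- in the interval of only one basis. A basis counted at a pair above `(k , l)` would have a
  -- corner with corank or nullity to spare.
  atMostOneLarge⇒tutteBound : ∀ {k l} → AtMostOneLarge k l → TutteBound k l
  atMostOneLarge⇒tutteBound {k} {l} unique =
    countL≤1⁺ (allSubsets-unique n) (λ {B} {B′} → counted-unique B B′) , zeros
    where
    counted-unique : ∀ B B′ → Counted k l B → Counted k l B′ → B ≡ B′
    counted-unique B B′ h h′ = optimal-unique crapoWeight-injective bB bB′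
      (interval⇒optimal bB (corner-interval B))
      (interval⇒optimal bB′ (subst (Interval B′) (sym corner≡) (corner-interval B′)))
      where
      bB : Basis B
      bB = proj₁ (counted⁻ B h)
      bB′ : Basis B′
      bB′ = proj₁ (counted⁻ B′ h′)
      corner≡ : corner B ≡ corner B′
      corner≡ = unique (counted⇒large B h) (counted⇒large B′ h′)
    absurd : ∀ {i j A} → (i , j) >₂ (k , l) → ¬ Large i j A
    absurd (k≤i , l≤j , ≢) large with m≤n⇒m<n∨m≡n k≤i | m≤n⇒m<n∨m≡n l≤j
    ... | inj₁ k<i | _ = atMostOneLarge⇒¬Large-suc-k unique (Large-mono k<i l≤j large)
    ... | inj₂ _ | inj₁ l<j = atMostOneLarge⇒¬Large-suc-l unique (Large-mono k≤i l<j large)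
    ... | inj₂ refl | inj₂ refl = ≢ refl
    zeros : ∀ i j → (i , j) >₂ (k , l) → tutteCoeff M i j ≡ 0
    zeros i j ij>kl = decidable-stable (tutteCoeff M i j ≟ℕ 0) λ t≢0 →
      let B , _ , h = countL>0⁻ (allSubsets n) t≢0 in absurd ij>kl (counted⇒large B h)

  -- `B` is the basis whose interval contains `A`. Its activities are at least the corank and
  -- nullity of `A`, hence at least `k` and `l`.
  large⇒corner : ∀ {k l A} → TutteBound k l → Large k l A → ∃[ B ] (Counted k l B × A ≡ corner B)
  large⇒corner {k} {l} {A} (_ , zeros) (c , d) = B , counted , interval≡corner bB ivl
      (≤-trans (≤-reflexive (cong proj₁ both)) k≤) (≤-trans (≤-reflexive (cong proj₂ both)) l≤)
    where
    B : Subset n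
    B = proj₁ (∃optimal (crapoWeight A))
    bB : Basis B
    bB = proj₁ (proj₂ (∃optimal (crapoWeight A)))
    ivl : Interval B A
    ivl = optimal⇒interval bB (proj₂ (proj₂ (∃optimal (crapoWeight A))))
    k≤ : k ≤ ∣ B ─ A ∣
    k≤ = +-cancelˡ-≤ (rank M A) _ _ (≤-trans c (≤-reflexive (interval-corank bB ivl)))
    l≤ : l ≤ ∣ A ─ B ∣
    l≤ = +-cancelˡ-≤ (rank M A) _ _ (≤-trans d (≤-reflexive (interval-nullity bB ivl)))
    both : (int M B , ext M B) ≡ (k , l)
    -- `B` is counted by the coefficient at its own activities, which would have to vanish if they
    -- differed from `(k , l)`.
    both = decidable-stable (≡-dec _≟ℕ_ _≟ℕ_ _ _) λ ≢ →
      countL>0⁺ (∈-allSubsets B) (counted⁺ bB) (zeros (int M B) (ext M B)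
      ( ≤-trans k≤ (≤-trans (p⊆q⇒∣p∣≤∣q∣ (interval-B─A⊆IA ivl)) (≤-reflexive (sym (int≡∣IA∣ B))))
      , ≤-trans l≤ (≤-trans (p⊆q⇒∣p∣≤∣q∣ (interval-A─B⊆EA ivl)) (≤-reflexive (sym (ext≡∣EA∣ B))))
      , ≢))
    counted : Counted k l B
    counted = subst (λ ij → Counted (proj₁ ij) (proj₂ ij) B) both (counted⁺ bB)

  tutteBound⇒atMostOneLarge : ∀ {k l} → TutteBound k l → AtMostOneLarge k l
  tutteBound⇒atMostOneLarge t large large′ =
    let B , counted , A≡ = large⇒corner t large
        B′ , counted′ , A′≡ = large⇒corner t large′
    in trans A≡ (trans (cong corner (countL≤1⁻ (proj₁ t) (∈-allSubsets B) (∈-allSubsets B′) counted counted′))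
                       (sym A′≡))

  -- Large sets and minors

  module _ {S C₀ A : Subset n} {k l : ℕ} (C₀⊆A : C₀ ⊆ A) (A⊆ : A ⊆ S ∪ C₀)
    (corank≥ : rank M A + k ≤ rank M (S ∪ C₀))
    (nullity≥ : rank M A + l + ∣ C₀ ∣ ≤ ∣ A ∣ + rank M C₀) where

    -- Choose bases `I₀` of `C₀` and `I ⊇ I₀` of `A`, and an independent `J ⊇ I` with `k` more
    -- elements. Contracting `I ─ C₀` makes the remaining elements of `A` loops and those of `J ─ I`
    -- independent. The loops must avoid `C₀`, so `nullity≥` discounts the nullity of `C₀`.
    large⇒minor : HasUkkU0lMinor M S C₀ k l
    large⇒minor with rank-attained C₀
    ... | I₀ , I₀⊆C₀ , iI₀ , I₀≡ with ∃basisOf⊇ {I₀} {A} (λ x∈ → C₀⊆A (I₀⊆C₀ x∈)) iI₀ | rank-attained (S ∪ C₀)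
    ... | I , I₀⊆I , I⊆A , iI , I≡ | Z , Z⊆ , iZ , Z≡
      with extend iI iZ (∣ I ∣ + k) (m≤m+n ∣ I ∣ k)
             (≤-trans (+-monoˡ-≤ k (≤-reflexive I≡)) (≤-trans corank≥ (≤-reflexive (sym Z≡))))
    ... | J , I⊆J , J⊆ , iJ , J≡ = conclude (∃⊆-of-size (A ─ (C₀ ∪ I)) l l≤)
      where
      C K C′ : Subset n
      C = I ─ C₀
      K = J ─ I
      C′ = C₀ ∪ C

      A⊆S : ∀ {x} → x ∈ A → x ∉ C₀ → x ∈ S
      A⊆S x∈A x∉C₀ with x∈p∪q⁻ S C₀ (A⊆ x∈A)
      ... | inj₁ x∈S = x∈S
      ... | inj₂ x∈C₀ = contradiction x∈C₀ x∉C₀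

      -- An element of `J` in `A` is already in `I`, by maximality of `I` in `A`.
      K∉A : ∀ {x} → x ∈ K → x ∉ A
      K∉A x∈K x∈A = let x∈J , x∉I = x∈p─q⁻ x∈K in
        x∉I (rank≤⇒maximal {I} {A} I⊆A (≤-reflexive (sym I≡)) x∈A (hereditary (p∪⁅x⁆⊆ I⊆J x∈J) iJ))

      K⊆S : K ⊆ S
      K⊆S x∈K with x∈p∪q⁻ I Z (J⊆ (proj₁ (x∈p─q⁻ x∈K)))
      ... | inj₁ x∈I = contradiction x∈I (proj₂ (x∈p─q⁻ x∈K))
      ... | inj₂ x∈Z with x∈p∪q⁻ S C₀ (Z⊆ x∈Z)
      ... | inj₁ x∈S = x∈S
      ... | inj₂ x∈C₀ = contradiction (C₀⊆A x∈C₀) (K∉A x∈K)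

      ∣K∣≡k : ∣ K ∣ ≡ k
      ∣K∣≡k = +-cancelˡ-≡ ∣ I ∣ ∣ K ∣ k (begin
        ∣ I ∣ + ∣ K ∣     ≡⟨ cong (λ p → ∣ p ∣ + ∣ K ∣) (⊆-antisym (λ x∈ → x∈p∩q⁺ (I⊆J x∈ , x∈)) (p∩q⊆q J I)) ⟩
        ∣ J ∩ I ∣ + ∣ K ∣ ≡⟨ sym (∣p∣≡∣p∩q∣+∣p─q∣ J I) ⟩
        ∣ J ∣             ≡⟨ J≡ ⟩
        ∣ I ∣ + k         ∎)
        where open ≡-Reasoning

      -- At most `∣ I ∣ + ∣ C₀ ─ I ∣` elements of `A` are excluded, and `C₀ ∩ I` contains the basis
      -- `I₀` of `C₀`.
      l≤ : l ≤ ∣ A ─ (C₀ ∪ I) ∣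
      l≤ = +-cancelʳ-≤ (∣ I ∣ + ∣ C₀ ∣) l _ (begin
        l + (∣ I ∣ + ∣ C₀ ∣)                         ≡⟨ sym (+-assoc l (∣ I ∣) (∣ C₀ ∣)) ⟩
        l + ∣ I ∣ + ∣ C₀ ∣                           ≡⟨ cong (_+ ∣ C₀ ∣) (trans (cong (l +_) I≡) (+-comm l (rank M A))) ⟩
        rank M A + l + ∣ C₀ ∣                        ≤⟨ nullity≥ ⟩
        ∣ A ∣ + rank M C₀                            ≡⟨ cong₂ _+_ (∣p∣≡∣p∩q∣+∣p─q∣ A (C₀ ∪ I)) (sym I₀≡) ⟩
        ∣ A ∩ (C₀ ∪ I) ∣ + ∣ A′ ∣ + ∣ I₀ ∣           ≤⟨ +-mono-≤ (+-monoˡ-≤ ∣ A′ ∣ (p⊆q⇒∣p∣≤∣q∣ ∩⊆)) (p⊆q⇒∣p∣≤∣q∣ I₀⊆∩) ⟩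
        ∣ I ∪ (C₀ ─ I) ∣ + ∣ A′ ∣ + ∣ C₀ ∩ I ∣       ≡⟨ cong (λ m → m + ∣ A′ ∣ + ∣ C₀ ∩ I ∣)
                                                         (∣p∪q∣-disjoint I (C₀ ─ I) λ x∈I x∈ → proj₂ (x∈p─q⁻ x∈) x∈I) ⟩
        ∣ I ∣ + ∣ C₀ ─ I ∣ + ∣ A′ ∣ + ∣ C₀ ∩ I ∣     ≡⟨ rearrange (∣ I ∣) (∣ C₀ ─ I ∣) (∣ A′ ∣) (∣ C₀ ∩ I ∣) ⟩
        ∣ A′ ∣ + (∣ I ∣ + (∣ C₀ ∩ I ∣ + ∣ C₀ ─ I ∣)) ≡⟨ cong (λ m → ∣ A′ ∣ + (∣ I ∣ + m)) (sym (∣p∣≡∣p∩q∣+∣p─q∣ C₀ I)) ⟩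
        ∣ A′ ∣ + (∣ I ∣ + ∣ C₀ ∣)                    ∎)
        where
        open ≤-Reasoning
        A′ : Subset n
        A′ = A ─ (C₀ ∪ I)
        rearrange : ∀ a b c d → a + b + c + d ≡ c + (a + (d + b))
        rearrange = solve-∀
        ∩⊆ : A ∩ (C₀ ∪ I) ⊆ I ∪ (C₀ ─ I)
        ∩⊆ {x} x∈ with x ∈? I | x∈p∪q⁻ C₀ I (proj₂ (x∈p∩q⁻ A (C₀ ∪ I) x∈))
        ... | yes x∈I | _ = p⊆p∪q (C₀ ─ I) x∈I
        ... | no x∉I | inj₁ x∈C₀ = q⊆p∪q I (C₀ ─ I) (x∈p∧x∉q⇒x∈p─q x∈C₀ x∉I)
        ... | no x∉I | inj₂ x∈I = contradiction x∈I x∉I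
        I₀⊆∩ : I₀ ⊆ C₀ ∩ I
        I₀⊆∩ x∈ = x∈p∩q⁺ (I₀⊆C₀ x∈ , I₀⊆I x∈)

      C′⊆A : C′ ⊆ A
      C′⊆A = p∪q⊆ C₀⊆A (λ x∈ → I⊆A (p─q⊆p I C₀ x∈))

      I⊆C′ : I ⊆ C′
      I⊆C′ {x} x∈I with x ∈? C₀
      ... | yes x∈C₀ = p⊆p∪q C x∈C₀
      ... | no x∉C₀ = q⊆p∪q C₀ C (x∈p∧x∉q⇒x∈p─q x∈I x∉C₀)

      rC′≡I : rank M C′ ≡ ∣ I ∣
      rC′≡I = ≤-antisym (≤-trans (rank-mono {C′} {A} C′⊆A) (≤-reflexive (sym I≡))) (indep⇒≤rank I⊆C′ iI)

      conclude : (∃[ L ] (L ⊆ A ─ (C₀ ∪ I) × ∣ L ∣ ≡ l)) → HasUkkU0lMinor M S C₀ k l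
      conclude (L , L⊆ , L≡) = C , K , L , C⊆S , K⊆S , L⊆S
        , disjoint⇒∩≡⊥ (λ x∈C x∈K → K∉A x∈K (I⊆A (p─q⊆p I C₀ x∈C)))
        , disjoint⇒∩≡⊥ (λ x∈C x∈L → L∉ x∈L (q⊆p∪q C₀ I (p─q⊆p I C₀ x∈C)))
        , disjoint⇒∩≡⊥ (λ x∈K x∈L → K∉A x∈K (L⊆A x∈L))
        , ∣K∣≡k , L≡ , λ X X⊆ → mk⇔ (to X X⊆) (λ X⊆K → X⊆ , from X X⊆K)
        where
        L⊆A : L ⊆ A
        L⊆A x∈ = proj₁ (x∈p─q⁻ (L⊆ x∈))
        L∉ : ∀ {x} → x ∈ L → x ∉ C₀ ∪ I
        L∉ x∈ = proj₂ (x∈p─q⁻ (L⊆ x∈))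
        L⊆S : L ⊆ S
        L⊆S x∈ = A⊆S (L⊆A x∈) (λ x∈C₀ → L∉ x∈ (p⊆p∪q I x∈C₀))
        C⊆S : C ⊆ S
        C⊆S x∈ = let x∈I , x∉C₀ = x∈p─q⁻ x∈ in A⊆S (I⊆A x∈I) x∉C₀

        from : ∀ X → X ⊆ K → rank M (X ∪ C′) ≡ ∣ X ∣ + rank M C′
        from X X⊆K = ≤-antisym
          (≤-trans (rank-∪≤ X C′) (+-monoˡ-≤ (rank M C′) (rank≤∣∣ X)))
          (begin
            ∣ X ∣ + rank M C′  ≡⟨ cong (∣ X ∣ +_) rC′≡I ⟩
            ∣ X ∣ + ∣ I ∣      ≡⟨ sym (∣p∪q∣-disjoint X I (λ x∈X → proj₂ (x∈p─q⁻ (X⊆K x∈X)))) ⟩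
            ∣ X ∪ I ∣          ≤⟨ indep⇒≤rank {X ∪ C′} (p∪q⊆ (p⊆p∪q C′) (λ x∈ → q⊆p∪q X C′ (I⊆C′ x∈)))
                                   (hereditary (p∪q⊆ (λ x∈ → proj₁ (x∈p─q⁻ (X⊆K x∈))) I⊆J) iJ) ⟩
            rank M (X ∪ C′)    ∎)
          where open ≤-Reasoning

        to : ∀ X → X ⊆ K ∪ L → IndepIn M (K ∪ L) C′ X → X ⊆ K
        to X X⊆ (_ , r≡) {x} x∈X with x∈p∪q⁻ K L (X⊆ x∈X)
        ... | inj₁ x∈K = x∈K
        -- As `x ∈ A` and `A` has the rank of `C′`, only `X - x` can raise the rank, which leaves it
        -- one short.
        ... | inj₂ x∈L = contradiction (begin
            suc (∣ X - x ∣ + rank M C′) ≡⟨ cong (_+ rank M C′) (∣p-x∣ x∈X) ⟩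
            ∣ X ∣ + rank M C′           ≡⟨ sym r≡ ⟩
            rank M (X ∪ C′)             ≤⟨ rank-mono {X ∪ C′} {(X - x) ∪ A} ⊆∪ ⟩
            rank M ((X - x) ∪ A)        ≤⟨ rank-∪≤ (X - x) A ⟩
            rank M (X - x) + rank M A   ≤⟨ +-mono-≤ (rank≤∣∣ (X - x)) (≤-reflexive (trans (sym I≡) (sym rC′≡I))) ⟩
            ∣ X - x ∣ + rank M C′       ∎) 1+n≰n
          where
          open ≤-Reasoning
          X⊆∪ : X ⊆ (X - x) ∪ A
          X⊆∪ {y} y∈X with y Fin.≟ x
          ... | yes refl = q⊆p∪q (X - x) A (L⊆A x∈L)
          ... | no y≢x = p⊆p∪q A (x∈p∧x≢y⇒x∈p-y y∈X y≢x)
          ⊆∪ : X ∪ C′ ⊆ (X - x) ∪ A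
          ⊆∪ = p∪q⊆ X⊆∪ (λ y∈ → q⊆p∪q (X - x) A (C′⊆A y∈))

  -- The large set is `C₀ ∪ C ∪ L`: the loops `L` do not raise the rank of `C₀ ∪ C` and supply the
  -- nullity, and the coloops `K` supply the corank.
  minor⇒large : ∀ {S C₀ k l} → (∀ {x} → x ∈ S → x ∉ C₀) → HasUkkU0lMinor M S C₀ k l →
                ∃[ A ] (Large k l A × C₀ ⊆ A × A ⊆ S ∪ C₀)
  minor⇒large {S} {C₀} {k} {l} disj
    (C , K , L , C⊆S , K⊆S , L⊆S , C∩K≡⊥ , C∩L≡⊥ , K∩L≡⊥ , K≡ , L≡ , indep⇔) =
    C′ ∪ L , (corank , nullity) , (λ x∈ → p⊆p∪q L (p⊆p∪q C x∈))
    , p∪q⊆ (p∪q⊆ (q⊆p∪q S C₀) (λ x∈ → p⊆p∪q C₀ (C⊆S x∈))) (λ x∈ → p⊆p∪q C₀ (L⊆S x∈))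
    where
    open ≤-Reasoning
    C′ : Subset n
    C′ = C₀ ∪ C

    e∈K : ∀ {e} → e ∈ L → rank M (⁅ e ⁆ ∪ C′) ≡ ∣ ⁅ e ⁆ ∣ + rank M C′ → e ∈ K
    e∈K {e} e∈L r≡ = Equivalence.to (indep⇔ ⁅ e ⁆ ⁅e⁆⊆) (⁅e⁆⊆ , r≡) (x∈⁅x⁆ e)
      where
      ⁅e⁆⊆ : ⁅ e ⁆ ⊆ K ∪ L
      ⁅e⁆⊆ x∈ rewrite x∈⁅y⁆⇒x≡y e x∈ = q⊆p∪q K L e∈L

    -- A basis of `C′` stays maximal in `C′ ∪ L`: an `e ∈ L` extending it would be independent in
    -- the minor, hence in `K`.
    rank≤C′ : rank M (C′ ∪ L) ≤ rank M C′
    rank≤C′ with rank-attained C′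
    ... | I , I⊆C′ , iI , I≡ = ≤-trans (maximal⇒rank≤ {I} {C′ ∪ L} iI λ e∈ → maximal e∈) (≤-reflexive I≡)
      where
      maximal : ∀ {e} → e ∈ C′ ∪ L → Indep (I ∪ ⁅ e ⁆) → e ∈ I
      maximal {e} e∈ i with x∈p∪q⁻ C′ L e∈
      ... | inj₁ e∈C′ = rank≤⇒maximal {I} {C′} I⊆C′ (≤-reflexive (sym I≡)) e∈C′ i
      ... | inj₂ e∈L = decidable-stable (e ∈? I) λ e∉I → ∩≡⊥⇒disjoint K∩L≡⊥
        (e∈K e∈L (≤-antisym (≤-trans (rank-∪≤ ⁅ e ⁆ C′) (+-monoˡ-≤ (rank M C′) (rank≤∣∣ ⁅ e ⁆))) (begin
          ∣ ⁅ e ⁆ ∣ + rank M C′ ≡⟨ cong₂ _+_ (∣⁅x⁆∣≡1 e) (sym I≡) ⟩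
          suc ∣ I ∣             ≡⟨ sym (∣p∪⁅x⁆∣ I e∉I) ⟩
          ∣ I ∪ ⁅ e ⁆ ∣         ≤⟨ indep⇒≤rank {⁅ e ⁆ ∪ C′}
                                    (p∪⁅x⁆⊆ (λ x∈ → q⊆p∪q ⁅ e ⁆ C′ (I⊆C′ x∈)) (p⊆p∪q C′ (x∈⁅x⁆ e))) i ⟩
          rank M (⁅ e ⁆ ∪ C′)   ∎))) e∈L

    corank : rank M (C′ ∪ L) + k ≤ rank M ⊤
    corank = begin
      rank M (C′ ∪ L) + k ≤⟨ +-monoˡ-≤ k rank≤C′ ⟩
      rank M C′ + k       ≡⟨ +-comm (rank M C′) k ⟩
      k + rank M C′       ≡⟨ cong (_+ rank M C′) (sym K≡) ⟩
      ∣ K ∣ + rank M C′   ≡⟨ sym (proj₂ (Equivalence.from (indep⇔ K (p⊆p∪q L)) id)) ⟩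
      rank M (K ∪ C′)     ≤⟨ rank-mono {K ∪ C′} {⊤} (λ _ → ∈⊤) ⟩
      rank M ⊤            ∎

    C′∩L : ∀ {x} → x ∈ C′ → x ∉ L
    C′∩L x∈ x∈L with x∈p∪q⁻ C₀ C x∈
    ... | inj₁ x∈C₀ = disj (L⊆S x∈L) x∈C₀
    ... | inj₂ x∈C = ∩≡⊥⇒disjoint C∩L≡⊥ x∈C x∈L

    nullity : rank M (C′ ∪ L) + l ≤ ∣ C′ ∪ L ∣
    nullity = begin
      rank M (C′ ∪ L) + l ≤⟨ +-monoˡ-≤ l (≤-trans rank≤C′ (rank≤∣∣ C′)) ⟩
      ∣ C′ ∣ + l          ≡⟨ cong (∣ C′ ∣ +_) (sym L≡) ⟩
      ∣ C′ ∣ + ∣ L ∣      ≡⟨ sym (∣p∪q∣-disjoint C′ L C′∩L) ⟩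
      ∣ C′ ∪ L ∣          ∎

  -- Deleting and contracting one element

  -- The first hypothesis says that `v` is a coloop. A basis `I` of `A - v` extends to a basis of
  -- the matroid, which contains `v`, so `I ∪ ⁅ v ⁆` is independent in `A`.
  coloop-rank : ∀ {A v} → rank M (⊤ - v) < rank M ⊤ → v ∈ A → rank M (A - v) < rank M A
  coloop-rank {A} {v} r< v∈A with rank-attained (A - v)
  ... | I , I⊆ , iI , I≡ with ∃basisOf⊇ {I} {⊤} (λ _ → ∈⊤) iI
  ... | J , I⊆J , _ , iJ , J≡ = begin-strict
    rank M (A - v) ≡⟨ sym I≡ ⟩
    ∣ I ∣          <⟨ ≤-reflexive (sym (∣p∪⁅x⁆∣ I λ v∈I → x∉p-x {p = A} (I⊆ v∈I))) ⟩
    ∣ I ∪ ⁅ v ⁆ ∣  ≤⟨ indep⇒≤rank (p∪⁅x⁆⊆ (λ x∈ → p─q⊆p A ⁅ v ⁆ (I⊆ x∈)) v∈A)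
                                  (hereditary (p∪⁅x⁆⊆ I⊆J v∈J) iJ) ⟩
    rank M A       ∎
    where
    open ≤-Reasoning
    v∈J : v ∈ J
    v∈J = decidable-stable (v ∈? J) λ v∉J → <⇒≱ r< (≤-trans (≤-reflexive (sym J≡))
      (indep⇒≤rank {⊤ - v} (λ x∈J → x∈p∧x≢y⇒x∈p-y ∈⊤ λ { refl → v∉J x∈J }) iJ))

  module _ {k l : ℕ} {v : Fin n} where

    avoiding⇒minor : ∀ {A} → v ∉ A → rank M A + k ≤ rank M (⊤ - v) → rank M A + l ≤ ∣ A ∣ →
                     HasUkkU0lMinor M (⊤ - v) ⊥ k l
    avoiding⇒minor {A} v∉A c d = large⇒minor {⊤ - v} {⊥} {A} ⊥⊆
      (λ x∈A → p⊆p∪q ⊥ (x∈p∧x≢y⇒x∈p-y ∈⊤ λ { refl → v∉A x∈A }))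
      (≤-trans c (rank-mono {⊤ - v} (p⊆p∪q ⊥)))
      (≤-trans (≤-reflexive (trans (cong (rank M A + l +_) (∣⊥∣≡0 n)) (+-identityʳ _)))
               (≤-trans d (m≤m+n ∣ A ∣ _)))

    -- The case `C₀ = ⁅ v ⁆` of `large⇒minor`; the `suc` is the size of `⁅ v ⁆`.
    containing⇒minor : ∀ {A} → v ∈ A → rank M A + k ≤ rank M ⊤ → suc (rank M A + l) ≤ ∣ A ∣ + rank M ⁅ v ⁆ →
                       HasUkkU0lMinor M (⊤ - v) ⁅ v ⁆ k l
    containing⇒minor {A} v∈A c d = large⇒minor {⊤ - v} {⁅ v ⁆} {A}
      (λ x∈ → subst (_∈ A) (sym (x∈⁅y⁆⇒x≡y v x∈)) v∈A)
      (λ _ → subst (_ ∈_) (sym ⊤≡) ∈⊤)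
      (≤-trans c (≤-reflexive (cong (rank M) (sym ⊤≡))))
      (≤-trans (≤-reflexive (trans (cong (rank M A + l +_) (∣⁅x⁆∣≡1 v)) (+-comm (rank M A + l) 1))) d)
      where
      ⊤≡ : (⊤ - v) ∪ ⁅ v ⁆ ≡ ⊤
      ⊤≡ = [p-x]∪⁅x⁆≡p ∈⊤

    module _ {A A′ : Subset n} (large : Large k l A) (large′ : Large k l A′) (v∈A : v ∈ A) (v∉A′ : v ∉ A′) where

      open Large
      open ≤-Reasoning

      separating⇒deletion-minor : HasUkkU0lMinor M (⊤ - v) ⊥ k l
      separating⇒deletion-minor with rank M ⊤ ≤? rank M (⊤ - v)
      ... | yes r≤ = avoiding⇒minor v∉A′ (≤-trans (corank≥ large′) r≤) (nullity≥ large′)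
      -- `v` is a coloop: removing it from `A` lowers rank and size by one each, and the total rank
      -- also drops by only one.
      ... | no r≰ = avoiding⇒minor (x∉p-x {p = A})
        (s≤s⁻¹ (begin
          suc (rank M (A - v)) + k ≤⟨ +-monoˡ-≤ k r< ⟩
          rank M A + k             ≤⟨ corank≥ large ⟩
          rank M ⊤                 ≡⟨ cong (rank M) (sym ([p-x]∪⁅x⁆≡p {p = ⊤} {x = v} ∈⊤)) ⟩
          rank M ((⊤ - v) ∪ ⁅ v ⁆) ≤⟨ rank-∪⁅⁆≤ (⊤ - v) v ⟩
          suc (rank M (⊤ - v))     ∎))
        (s≤s⁻¹ (begin
          suc (rank M (A - v)) + l ≤⟨ +-monoˡ-≤ l r< ⟩
          rank M A + l             ≤⟨ nullity≥ large ⟩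
          ∣ A ∣                    ≡⟨ sym (∣p-x∣ v∈A) ⟩
          suc ∣ A - v ∣            ∎))
        where
        r< : rank M (A - v) < rank M A
        r< = coloop-rank (≰⇒> r≰) v∈A

      separating⇒contraction-minor : HasUkkU0lMinor M (⊤ - v) ⁅ v ⁆ k l
      separating⇒contraction-minor with 1 ≤? rank M ⁅ v ⁆
      ... | yes 1≤ = containing⇒minor v∈A (corank≥ large) (begin
          suc (rank M A + l)     ≡⟨ +-comm 1 (rank M A + l) ⟩
          rank M A + l + 1       ≤⟨ +-mono-≤ (nullity≥ large) 1≤ ⟩
          ∣ A ∣ + rank M ⁅ v ⁆   ∎)
      -- `v` is a loop: adding it to `A′` keeps the rank, and the additional element pays for the
      -- `suc`.
      ... | no 1≰ = containing⇒minor {A′ ∪ ⁅ v ⁆} x∈p∪⁅x⁆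
          (≤-trans (+-monoˡ-≤ k r≤) (corank≥ large′)) (begin
          suc (rank M (A′ ∪ ⁅ v ⁆) + l)       ≤⟨ s≤s (+-monoˡ-≤ l r≤) ⟩
          suc (rank M A′ + l)                 ≤⟨ s≤s (nullity≥ large′) ⟩
          suc ∣ A′ ∣                          ≡⟨ sym (∣p∪⁅x⁆∣ A′ v∉A′) ⟩
          ∣ A′ ∪ ⁅ v ⁆ ∣                      ≤⟨ m≤m+n _ _ ⟩
          ∣ A′ ∪ ⁅ v ⁆ ∣ + rank M ⁅ v ⁆       ∎)
        where
        r≤ : rank M (A′ ∪ ⁅ v ⁆) ≤ rank M A′
        r≤ = begin
          rank M (A′ ∪ ⁅ v ⁆)      ≤⟨ rank-∪≤ A′ ⁅ v ⁆ ⟩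
          rank M A′ + rank M ⁅ v ⁆ ≤⟨ +-monoʳ-≤ (rank M A′) (≮⇒≥ 1≰) ⟩
          rank M A′ + 0            ≡⟨ +-identityʳ _ ⟩
          rank M A′                ∎

  -- Almost uniformity and large sets

  almostUniform⇒atMostOneLarge : ∀ {k l} → AlmostUniform M k l → AtMostOneLarge k l
  almostUniform⇒atMostOneLarge {k} {l} almost large large′ =
    ⊆-antisym (included large large′) (included large′ large)
    where
    included : ∀ {A A′} → Large k l A → Large k l A′ → A ⊆ A′
    included {A} {A′} large large′ {v} v∈A = decidable-stable (v ∈? A′) λ v∉A′ →
      [ (λ uniform → uniform (separating⇒deletion-minor large large′ v∈A v∉A′))
      , (λ uniform → uniform (separating⇒contraction-minor large large′ v∈A v∉A′)) ]′ (almost v)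

  deletion-minor⇒large : ∀ {k l v} → HasUkkU0lMinor M (⊤ - v) ⊥ k l → ∃[ A ] (Large k l A × v ∉ A)
  deletion-minor⇒large {v = v} minor with minor⇒large (λ _ → ∉⊥) minor
  ... | A , large , _ , A⊆ = A , large , λ v∈A →
    [ x∉p-x {p = ⊤} , ∉⊥ ]′ (x∈p∪q⁻ (⊤ - v) ⊥ (A⊆ v∈A))

  contraction-minor⇒large : ∀ {k l v} → HasUkkU0lMinor M (⊤ - v) ⁅ v ⁆ k l → ∃[ A ] (Large k l A × v ∈ A)
  contraction-minor⇒large {v = v} minor
    with minor⇒large (λ x∈ x∈v → proj₂ (x∈p─q⁻ {p = ⊤} x∈) x∈v) minor
  ... | A , large , v⊆A , _ = A , large , v⊆A (x∈⁅x⁆ v)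

  -- If there is a large set `A`, whether it contains `v` decides the side: a forbidden minor of the
  -- deletion (for `v ∈ A`) or of the contraction (for `v ∉ A`) would give a large set that differs
  -- from `A` at `v`.
  atMostOneLarge⇒almostUniform : ∀ {k l} → AtMostOneLarge k l → AlmostUniform M k l
  atMostOneLarge⇒almostUniform {k} {l} unique v with anySubset? (Large? k l)
  ... | no ∄ = inj₁ λ minor → let A , large , _ = deletion-minor⇒large minor in ∄ (A , large)
  ... | yes (A , large) with v ∈? A
  ... | yes v∈A = inj₁ λ minor → let A′ , large′ , v∉A′ = deletion-minor⇒large minor in
    v∉A′ (subst (v ∈_) (unique large large′) v∈A)
  ... | no v∉A = inj₂ λ minor → let A′ , large′ , v∈A′ = contraction-minor⇒large minor in
    v∉A (subst (v ∈_) (unique large′ large) v∈A′)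

theorem1p2 : (n : ℕ) (M : Matroid n) (k l : ℕ) → 1 ≤ k → 1 ≤ l →
    (AlmostUniform M k l ⇔
    (tutteCoeff M k l ≤ 1 × (∀ i j → (i , j) >₂ (k , l) → tutteCoeff M i j ≡ 0)))
theorem1p2 n M k l _ _ = mk⇔
  (λ almost → atMostOneLarge⇒tutteBound (almostUniform⇒atMostOneLarge almost))
  (λ tutte → atMostOneLarge⇒almostUniform (tutteBound⇒atMostOneLarge tutte))
  where open MatroidProperties M
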